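{- Let $a,b$ be two torically incomparable elements in the toric poset $[Q]$. (i) If $a,b$ are in different connected components of the underlying graph of $[Q]$, then $[Q_{a\to b}]=[Q_{b\to a}]$ and $\mathcal{L}_{\rm tor}([Q])=\mathcal{L}_{\rm tor}([Q_{a\to b}])=\mathcal{L}_{\rm tor}([Q_{b\to a}])$. (ii) If $a,b$ are in the same connected component of the underlying graph of $[Q]$ and $Q'\in[Q]$ is a representative in which $a,b$ are (ordinary) incomparable, then $\mathcal{L}_{\rm tor}([Q'_{a\to b}])$ and $\mathcal{L}_{\rm tor}([Q'_{b\to a}])$ are disjoint subsets of $\mathcal{L}_{\rm tor}([Q])$; but the inclusion $\mathcal{L}_{\rm tor}([Q'_{a\to b}])\sqcup\mathcal{L}_{\rm tor}([Q'_{b\to a}])\subseteq\mathcal{L}_{\rm tor}([Q])$ may be proper (i.e. there exist such $Q,a,b,Q'$ for which it is proper). (iii) Assume that $a,b$ are at distance two in the underlying graph of the toric transitive closure $\overline{[Q]}$, say both adjacent to the vertex $v$. If $Q'\in\overline{[Q]}_v$, that is, $Q'$ is a representative of $\overline{[Q]}$ having $v$ as a source, then $$\mathcal{L}_{\rm tor}([Q])=\mathcal{L}_{\rm tor}([Q'_{a\to b}])\sqcup\mathcal{L}_{\rm tor}([Q'_{b\to a}]).$$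
   Context: All quivers are finite directed graphs that are simple (no loops, no parallel or anti-parallel arcs) and acyclic (no directed cycles), on a vertex set $V=[n]$. A source is a vertex all of whose incident arcs point away from it; a sink is a vertex all of whose incident arcs point into it (an isolated vertex is both). A flip at a source or sink $k$ reverses all arcs incident to $k$. Two acyclic quivers are equivalent if they are related by a finite sequence of flips; the equivalence class $[Q]$ is called a toric poset; all its members have the same underlying undirected graph. A quiver $Q$ induces a poset on $V$ by $i<j$ if there is a directed path from $i$ to $j$; "ordinary (in)comparable" refers to this poset. If neither $a\to b$ nor $b\to a$ is in $Q$, then $Q_{a\to b}$ is $Q$ with the arc $a\to b$ added (similarly $Q_{b\to a}$). A toric directed path in $Q'$ is a sequence of distinct vertices $y_1,\dots,y_m$ such that $Q'$ contains the arcs $y_1\to y_2\to\cdots\to y_m$ and also the arc $y_1\to y_m$ (a single vertex and a single arc also count). A toric chain of $[Q]$ is a subset of $V$ that is totally ordered in the poset induced by every quiver in $[Q]$; it is known that a subset is a toric chain if and only if its elements lie on a common toric directed path (in one, equivalently every, $Q'\in[Q]$). Two elements are torically comparable if they lie on a common toric chain, and torically incomparable otherwise. For $Q'\in[Q]$, the toric transitive closure $\overline{Q'}$ is obtained from $Q'$ by adding, for all $i,j$ lying on a common toric chain, the arc $i\to j$ where $i$ precedes $j$ along a toric directed path of $Q'$ containing both. The toric transitive closure of $[Q]$ is $\overline{[Q]}:=[\overline{Q'}]$, known to be independent of the choice of $Q'\in[Q]$. $\overline{[Q]}_v$ is the set of quivers in $\overline{[Q]}$ having $v$ as a source. A toric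 total order $[w]=[(w_1,\dots,w_n)]$ is the equivalence class of a permutation of $V$ under cyclic rotation. For a graph $G$ on $V$, let $\mathcal{A}_{\rm tor}(G)$ be the image in $\mathbb{R}^n/\mathbb{Z}^n$ of $\bigcup_{\{i,j\}\in G}\{x_i=x_j\}\subset\mathbb{R}^n$. A point of $\mathbb{R}^n/\mathbb{Z}^n-\mathcal{A}_{\rm tor}(G)$ determines an acyclic orientation of $G$: $i\to j$ if $x_i \bmod 1< x_j \bmod 1$ (values in $[0,1)$), and $j\to i$ otherwise. For a toric poset $[Q]$ with underlying graph $G$, its toric chamber $c_{[Q]}$ is the set of points whose orientation lies in $[Q]$ (these sets are exactly the connected components of $\mathbb{R}^n/\mathbb{Z}^n-\mathcal{A}_{\rm tor}(G)$). For a toric total order $[w]$, $c_{[w]}$ is the set of points with pairwise distinct coordinates such that listing the indices in increasing order of $x_i\bmod 1$ gives a member of $[w]$. $[w]$ is a toric total extension of $[Q]$ if $c_{[w]}\subseteq c_{[Q]}$; the set of these is $\mathcal{L}_{\rm tor}([Q])$. -}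

module Defs where

open import Level using (0ℓ; suc)
open import Data.Bool using (if_then_else_; _∨_)
open import Data.Fin using (Fin; _≟_)
open import Data.Fin.Subset using (Subset) renaming (_∈_ to _∈ₛ_)
open import Data.Integer using (ℤ)
open import Data.List using (List; []; _∷_; [_]; _++_; _∷ʳ_; allFin)
open import Data.List.Relation.Binary.Permutation.Propositional using (_↭_)
open import Data.List.Relation.Binary.Sublist.Propositional using () renaming (_⊆_ to _⊑_)
open import Data.List.Relation.Unary.AllPairs using (AllPairs)
open import Data.List.Relation.Unary.Linked using (Linked)
open import Data.List.Relation.Unary.Unique.Propositional using (Unique)
open import Data.Nat as ℕ using (ℕ)
open import Data.Product using (∃; ∃₂; _×_; _,_)
open import Data.Rational using (ℚ; 0ℚ; 1ℚ; _/_; _+_; _-_; -_) renaming (_<_ to _<ᵠ_)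
import Data.Rational.Properties as ℚₚ
open import Data.Sum using (_⊎_; inj₁; inj₂)
open import Relation.Binary using (Rel; _⇔_; tri<; tri≈; tri>)
open import Relation.Binary.Construct.Closure.ReflexiveTransitive using (Star)
open import Relation.Binary.Construct.Closure.Symmetric using (SymClosure)
open import Relation.Binary.Construct.Closure.Transitive using (TransClosure)
open import Relation.Binary.Definitions using (Decidable)
open import Relation.Binary.PropositionalEquality using (_≡_; refl; sym; trans; cong; subst)
open import Relation.Nullary using (¬_; does)
open import Relation.Unary using (Pred; _∈_; _∉_; _⊆_)

private
  variable
    n : ℕ

Digraph : ℕ → Set₁
Digraph n = Rel (Fin n) 0ℓ

-- Graphs on V are given by their (symmetric) adjacency relations.
Graph : ℕ → Set₁
Graph n = Rel (Fin n) 0ℓ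

underlying : Digraph n → Graph n
underlying = SymClosure

-- A loop is a directed cycle of length 1 and a pair of anti-parallel arcs is
-- one of length 2, so this includes simplicity (a relation has no parallel
-- arcs).
Acyclic : Digraph n → Set
Acyclic E = ∀ i → ¬ TransClosure E i i

-- `decidable` records, constructively, that the arcs form a finite set.
record IsQuiver (E : Digraph n) : Set where
  field
    decidable : Decidable E
    acyclic   : Acyclic E

Source Sink : Digraph n → Fin n → Set
Source E k = ∀ i → ¬ E i k
Sink   E k = ∀ i → ¬ E k i

flip : Fin n → Digraph n → Digraph n
flip k E i j = if does (i ≟ k) ∨ does (j ≟ k) then E j i else E i j

-- Digraphs are identified when they have the same arcs; `_⇔_` is mutual
-- inclusion of relations.
data Step {n} (E F : Digraph n) : Set₁ where
  same    : E ⇔ F → Step E F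
  flipped : ∀ k → Source E k ⊎ Sink E k → flip k E ⇔ F → Step E F

_∼_ : Rel (Digraph n) (suc 0ℓ)
_∼_ = Star Step

-- The toric poset [ E ], as a set of digraphs.
[_]ₜ : Digraph n → Pred (Digraph n) (suc 0ℓ)
[ E ]ₜ F = E ∼ F

addArc : Digraph n → Fin n → Fin n → Digraph n
addArc E a b i j = E i j ⊎ (i ≡ a × j ≡ b)

Comparable Incomparable : Digraph n → Rel (Fin n) 0ℓ
Comparable   E i j = Star E i j ⊎ Star E j i
Incomparable E i j = ¬ Comparable E i j

SameComponent : Graph n → Rel (Fin n) 0ℓ
SameComponent = Star

data Walk {n} (G : Graph n) : ℕ → Fin n → Fin n → Set where
  nil  : ∀ {i} → Walk G 0 i i
  cons : ∀ {m i j k} → G i j → Walk G m j k → Walk G (ℕ.suc m) i k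

Distance : Graph n → Fin n → Fin n → ℕ → Set
Distance G i j d = Walk G d i j × (∀ m → Walk G m i j → d ℕ.≤ m)

ToricChain : Digraph n → Subset n → Set₁
ToricChain E C =
  ∀ F → F ∈ [ E ]ₜ → ∀ i j → i ∈ₛ C → j ∈ₛ C → Comparable F i j

ToricComparable ToricIncomparable : Digraph n → Fin n → Fin n → Set₁
ToricComparable   E i j = ∃ λ C → ToricChain E C × i ∈ₛ C × j ∈ₛ C
ToricIncomparable E i j = ¬ ToricComparable E i j

-- With `ys` empty, `path` says that a single arc is a toric directed path.
data ToricPath {n} (E : Digraph n) : List (Fin n) → Set where
  single : ∀ y → ToricPath E [ y ]
  path   : ∀ y ys z → Unique (y ∷ (ys ∷ʳ z)) → Linked E (y ∷ (ys ∷ʳ z)) → E y z →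
           ToricPath E (y ∷ (ys ∷ʳ z))

-- `i ∷ j ∷ [] ⊑ ys` (sublist) says that i precedes j in ys.  That i and j lie
-- on a common toric chain need not be asked separately: the vertices of a
-- toric directed path always form a toric chain.
toricClosure : Digraph n → Digraph n
toricClosure E i j = E i j ⊎ ∃ λ ys → ToricPath E ys × (i ∷ j ∷ []) ⊑ ys

-- Dedekind cuts of ℚ.
record ℝ : Set₁ where
  field
    Lower Upper    : Pred ℚ 0ℓ
    lowerInhabited : ∃ Lower
    upperInhabited : ∃ Upper
    lowerOpen      : ∀ {q} → Lower q → ∃ λ r → q <ᵠ r × Lower r
    lowerClosed    : ∀ {q r} → q <ᵠ r → Lower r → Lower q
    upperOpen      : ∀ {r} → Upper r → ∃ λ q → q <ᵠ r × Upper q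
    upperClosed    : ∀ {q r} → q <ᵠ r → Upper q → Upper r
    disjoint       : ∀ {q} → ¬ (Lower q × Upper q)
    located        : ∀ {q r} → q <ᵠ r → Lower q ⊎ Upper r

open ℝ

infix 4 _<_ _≤_ _≈_

_<_ : Rel ℝ 0ℓ
x < y = ∃ λ q → Upper x q × Lower y q

_≤_ : Rel ℝ 0ℓ
x ≤ y = Lower x ⊆ Lower y

_≈_ : Rel ℝ 0ℓ
x ≈ y = x ≤ y × y ≤ x

private
  p-1<p : ∀ p → p - 1ℚ <ᵠ p
  p-1<p p = subst (p - 1ℚ <ᵠ_) (ℚₚ.+-identityʳ p) (ℚₚ.+-monoʳ-< p (ℚₚ.negative⁻¹ (- 1ℚ)))

  p<p+1 : ∀ p → p <ᵠ p + 1ℚ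
  p<p+1 p = subst (_<ᵠ p + 1ℚ) (ℚₚ.+-identityʳ p) (ℚₚ.+-monoʳ-< p (ℚₚ.positive⁻¹ 1ℚ))

  q+p-p : ∀ q p → q + p - p ≡ q
  q+p-p q p = trans (ℚₚ.+-assoc q p (- p))
                (trans (cong (q +_) (ℚₚ.+-inverseʳ p)) (ℚₚ.+-identityʳ q))

  q-p+p : ∀ q p → q - p + p ≡ q
  q-p+p q p = trans (ℚₚ.+-assoc q (- p) p)
                (trans (cong (q +_) (ℚₚ.+-inverseˡ p)) (ℚₚ.+-identityʳ q))

  q-p<r⇒q<r+p : ∀ {q r} p → q - p <ᵠ r → q <ᵠ r + p
  q-p<r⇒q<r+p {q} {r} p lt = subst (_<ᵠ r + p) (q-p+p q p) (ℚₚ.+-monoˡ-< p lt)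

  q<r-p⇒q+p<r : ∀ {q r} p → q <ᵠ r - p → q + p <ᵠ r
  q<r-p⇒q+p<r {q} {r} p lt = subst (q + p <ᵠ_) (q-p+p r p) (ℚₚ.+-monoˡ-< p lt)

fromℚ : ℚ → ℝ
fromℚ p = record
  { Lower          = λ q → q <ᵠ p
  ; Upper          = λ q → p <ᵠ q
  ; lowerInhabited = p - 1ℚ , p-1<p p
  ; upperInhabited = p + 1ℚ , p<p+1 p
  ; lowerOpen      = λ q<p → let r , q<r , r<p = ℚₚ.<-dense q<p in r , q<r , r<p
  ; lowerClosed    = ℚₚ.<-trans
  ; upperOpen      = λ p<r → let q , p<q , q<r = ℚₚ.<-dense p<r in q , q<r , p<q
  ; upperClosed    = λ q<r p<q → ℚₚ.<-trans p<q q<r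
  ; disjoint       = λ (q<p , p<q) → ℚₚ.<-asym q<p p<q
  ; located        = loc
  }
  where
  loc : ∀ {q r} → q <ᵠ r → q <ᵠ p ⊎ p <ᵠ r
  loc {q} {r} q<r with ℚₚ.<-cmp q p
  ... | tri< q<p _ _    = inj₁ q<p
  ... | tri≈ _ refl _   = inj₂ q<r
  ... | tri> _ _ p<q    = inj₂ (ℚₚ.<-trans p<q q<r)

_+ᵠ_ : ℝ → ℚ → ℝ
x +ᵠ p = record
  { Lower          = λ q → Lower x (q - p)
  ; Upper          = λ q → Upper x (q - p)
  ; lowerInhabited = let q , l = lowerInhabited x in
                     q + p , subst (Lower x) (sym (q+p-p q p)) l
  ; upperInhabited = let q , u = upperInhabited x in
                     q + p , subst (Upper x) (sym (q+p-p q p)) u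
  ; lowerOpen      = λ l → let r , lt , l′ = lowerOpen x l in
                     r + p , q-p<r⇒q<r+p p lt , subst (Lower x) (sym (q+p-p r p)) l′
  ; lowerClosed    = λ q<r → lowerClosed x (ℚₚ.+-monoˡ-< (- p) q<r)
  ; upperOpen      = λ u → let q , lt , u′ = upperOpen x u in
                     q + p , q<r-p⇒q+p<r p lt , subst (Upper x) (sym (q+p-p q p)) u′
  ; upperClosed    = λ q<r → upperClosed x (ℚₚ.+-monoˡ-< (- p) q<r)
  ; disjoint       = disjoint x
  ; located        = λ q<r → located x (ℚₚ.+-monoˡ-< (- p) q<r)
  }

-- A point of ℝⁿ/ℤⁿ is given by a representative in ℝⁿ; subsets of ℝⁿ/ℤⁿ are
-- predicates invariant under `_≡ℤ_`.
Point : ℕ → Set₁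
Point n = Fin n → ℝ

_≡ℤ_ : Rel (Point n) 0ℓ
x ≡ℤ y = ∀ i → ∃ λ (k : ℤ) → x i ≈ (y i +ᵠ (k / 1))

-- `x mod1= r`: r is the representative of x with coordinates in [0,1).  It is
-- a relation because the fractional part is not computable on ℝ.
_mod1=_ : Rel (Point n) 0ℓ
x mod1= r = x ≡ℤ r × (∀ i → fromℚ 0ℚ ≤ r i × r i < fromℚ 1ℚ)

𝓐tor : Graph n → Pred (Point n) (suc 0ℓ)
𝓐tor G x = ∃ λ y → x ≡ℤ y × ∃₂ λ i j → G i j × y i ≈ y j

-- The orientation of G determined by coordinates r in [0,1).
orientation : Graph n → Point n → Digraph n
orientation G r i j = G i j × r i < r j

chamber : Digraph n → Pred (Point n) (suc 0ℓ)
chamber E x =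
  x ∉ 𝓐tor (underlying E) ×
  ∃ λ r → x mod1= r × orientation (underlying E) r ∈ [ E ]ₜ

-- A toric total order [w] is given by a representative w; sets of toric total
-- orders are predicates invariant under `_↻_`.
TotalOrder : ℕ → Set
TotalOrder n = ∃ λ (w : List (Fin n)) → w ↭ allFin n

_↻_ : Rel (List (Fin n)) 0ℓ
w ↻ w′ = ∃₂ λ us vs → w ≡ us ++ vs × w′ ≡ vs ++ us

-- `AllPairs` also makes the coordinates pairwise distinct, since w′ lists all
-- indices.
chamberₒ : TotalOrder n → Pred (Point n) (suc 0ℓ)
chamberₒ (w , _) x =
  ∃ λ r → x mod1= r × ∃ λ w′ → w ↻ w′ × AllPairs (λ i j → r i < r j) w′

𝓛tor : Digraph n → Pred (TotalOrder n) (suc 0ℓ)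
𝓛tor E w = chamberₒ w ⊆ chamber E

{-# OPTIONS --safe #-}
module Submission where

-- Attach to a sequence of flips the function h counting how often each vertex
-- has been turned (up to a common constant).  It turns the flip equivalence
-- into a local condition on arcs, `Winds`.  Applied to the orientation induced
-- by a total order w, the condition says that w together with h describes a
-- lift of the cyclic order to ℤ, f i = p i + N h i with p the position in w,
-- such that f i < f j < f i + N for every arc i → j; [w] is a toric total
-- extension exactly when such a lift exists.  On lifts the theorem is short:
-- in different components one component can be turned until b follows a; in
-- one component the lift is rigid, so adding a → b and adding b → a exclude
-- each other; and if v → a and v → b then a and b are lifted into the same
-- interval (f v, f v + N), so that one of the two arcs fits.

open import Defs
open import Data.Bool using (if_then_else_)
open import Data.Empty using (⊥-elim)
open import Data.Fin using (Fin; zero; suc; _≟_)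
open import Data.Fin.Patterns using (0F; 1F; 2F; 3F)
open import Data.Fin.Properties using (all?; any?; ¬∀⟶∃¬)
open import Data.Fin.Subset using (⁅_⁆) renaming (_∪_ to _∪ₛ_; _∈_ to _∈ₛ_)
open import Data.Fin.Subset.Properties using (x∈⁅x⁆; x∈⁅y⁆⇒x≡y; x∈p∪q⁺; x∈p∪q⁻)
open import Data.Integer as ℤ using (ℤ; -[1+_]; +<+; +≤+)
import Data.Integer.Properties as ℤₚ
open import Data.List using (List; []; _∷_; _++_; _∷ʳ_; length; allFin)
open import Data.List.Extrema.Nat using (argmax; f[xs]≤f[argmax])
open import Data.List.Membership.DecPropositional using () renaming (_∈?_ to ∈?)
open import Data.List.Membership.Propositional using () renaming (_∈_ to _∈ˡ_)
open import Data.List.Membership.Propositional.Properties using (∈-allFin; ∈-++⁺ˡ; ∈-++⁺ʳ; ∈-++⁻)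
open import Data.List.Properties using (++-identityʳ)
open import Data.List.Relation.Binary.Permutation.Propositional using (_↭_; prep; ↭-sym; ↭-trans; ↭⇒↭ₛ)
open import Data.List.Relation.Binary.Permutation.Propositional.Properties using (∈-resp-↭; ++-comm; ↭-reverse)
import Data.List.Relation.Binary.Permutation.Setoid.Properties as Permutationₛ
open import Data.List.Relation.Binary.Sublist.Propositional as Sublist using () renaming (_⊆_ to _⊑_)
open import Data.List.Relation.Binary.Sublist.Propositional.Properties using (∷ˡ⁻)
open import Data.List.Relation.Unary.All as All using (All; []; _∷_)
open import Data.List.Relation.Unary.AllPairs as AllPairs using (AllPairs; []; _∷_)
open import Data.List.Relation.Unary.Any using (here; there)
import Data.List.Relation.Unary.Linked as Linked
open import Data.List.Relation.Unary.Linked.Properties using (Linked⇒AllPairs)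
open import Data.List.Relation.Unary.Unique.Propositional using (Unique)
open import Data.List.Relation.Unary.Unique.Propositional.Properties using (allFin⁺)
open import Data.Nat as ℕ using (ℕ; zero; suc; _+_; _*_; z≤n; s≤s)
open import Data.Nat.Induction using (Acc; acc; <-wellFounded)
import Data.Nat.Properties as ℕₚ
import Data.Nat.Solver as ℕ-Solver
open import Data.Product using (Σ; ∃; ∃₂; _×_; _,_; proj₁; proj₂; map₂)
open import Data.Rational as ℚ using (ℚ; 0ℚ; 1ℚ; toℚᵘ; fromℚᵘ)
import Data.Rational.Properties as ℚₚ
import Data.Rational.Solver as ℚ-Solver
open import Data.Rational.Unnormalised as ℚᵘ using (mkℚᵘ; *<*; *≤*; *≡*)
import Data.Rational.Unnormalised.Properties as ℚᵘₚ
open import Data.Sum as Sum using (_⊎_; inj₁; inj₂; swap; [_,_]′)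
open import Function using (id; _∘_; case_of_)
open import Relation.Binary using (Rel; _⇒_; _⇔_; Decidable; tri<; tri≈; tri>)
open import Relation.Binary.Construct.Closure.ReflexiveTransitive as Star using (Star; ε; _◅_; _◅◅_; _⋆; return)
open import Relation.Binary.Construct.Closure.Symmetric using (fwd; bwd)
open import Relation.Binary.Construct.Closure.Transitive using (TransClosure; [_]; _∷_) renaming (_++_ to _⁺++_)
open import Relation.Binary.PropositionalEquality hiding ([_])
open import Relation.Nullary using (¬_; Dec; yes; no; does; contradiction; ¬?; map′; _×-dec_; _⊎-dec_)
open import Relation.Unary using (_∈_; _∉_; _⊆_; _≐_; _∪_; _⊥_)

private
  variable
    n : ℕ

open ℝ

-- Turn counts of flip sequences.

𝟙 : ∀ {p} {P : Set p} → Dec P → ℕ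
𝟙 d = if does d then 1 else 0

-- Every arc of E is an arc of D, reversed exactly if its ends were turned a
-- different number of times on the way from D to E.  Adding a constant to h
-- changes nothing, so a sink can be flipped by incrementing h everywhere else,
-- and h need never be negative.
record Winds (h : Fin n → ℕ) (D E : Digraph n) : Set where
  constructor winding
  field
    wind : ∀ {i j} → E i j → (h i ≡ h j × D i j) ⊎ (h j ≡ suc (h i) × D j i)

open Winds

-- Turn counts add. An arc reversed twice is an arc of `D` again, and its two jumps by one go in
-- opposite directions, so they cancel.
Winds-trans : {D E F : Digraph n} {h k : Fin n → ℕ} →
              Winds h D E → Winds k E F → Winds (λ i → h i + k i) D F
Winds-trans {D = D} {E} {F} {h} {k} DE EF = winding go
  where
  go : ∀ {i j} → F i j → (h i + k i ≡ h j + k j × D i j) ⊎ (h j + k j ≡ suc (h i + k i) × D j i)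
  go {i} {j} f with wind EF f
  go {i} {j} f | inj₁ (ki≡kj , e) with wind DE e
  ... | inj₁ (hi≡hj , d)   = inj₁ (cong₂ _+_ hi≡hj ki≡kj , d)
  ... | inj₂ (hj≡1+hi , d) = inj₂ (cong₂ _+_ hj≡1+hi (sym ki≡kj) , d)
  go {i} {j} f | inj₂ (kj≡1+ki , e) with wind DE e
  ... | inj₁ (hj≡hi , d)   = inj₂ (trans (cong₂ _+_ hj≡hi kj≡1+ki) (ℕₚ.+-suc (h i) (k i)) , d)
  ... | inj₂ (hi≡1+hj , d) =
    inj₁ (trans (cong (_+ k i) hi≡1+hj)
           (trans (sym (ℕₚ.+-suc (h j) (k i))) (cong (h j +_) (sym kj≡1+ki))) , d)

Winds-refl : {D : Digraph n} → Winds (λ _ → 0) D D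
Winds-refl = winding λ d → inj₁ (refl , d)

Winds-mono : {D D′ E E′ : Digraph n} {h : Fin n → ℕ} →
             D ⇒ D′ → E′ ⇒ E → Winds h D E → Winds h D′ E′
Winds-mono D⊆D′ E′⊆E DE = winding λ e →
  Sum.map (map₂ D⊆D′) (map₂ D⊆D′) (wind DE (E′⊆E e))

-- Takes off the common constant that appears when a sink is flipped by raising all other vertices.
Winds-pred : {D E : Digraph n} {h k : Fin n → ℕ} → (∀ i → k i ≡ suc (h i)) →
             Winds k D E → Winds h D E
Winds-pred k≡1+h DE = winding λ {i} {j} e → Sum.map
  (λ (eq , d) → ℕₚ.suc-injective (trans (sym (k≡1+h i)) (trans eq (k≡1+h j))) , d)
  (λ (eq , d) → ℕₚ.suc-injective (trans (sym (k≡1+h j)) (trans eq (cong suc (k≡1+h i)))) , d)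
  (wind DE e)

-- Along a path of `E` the count never decreases, so around a cycle it is constant; then no arc of
-- the cycle is reversed and the cycle already lies in `D`.
Winds-acyclic : {D E : Digraph n} {h : Fin n → ℕ} → Winds h D E → Acyclic D → Acyclic E
Winds-acyclic {D = D} {E} {h} DE D-acyclic i c with climb c
  where
  climb : ∀ {i j} → TransClosure E i j → h i ℕ.< h j ⊎ (h i ≡ h j × TransClosure D i j)
  climb [ e ] with wind DE e
  ... | inj₁ (eq , d) = inj₂ (eq , [ d ])
  ... | inj₂ (eq , _) = inj₁ (ℕₚ.≤-reflexive (sym eq))
  climb (e ∷ c) with wind DE e | climb c
  ... | inj₁ (eq , d) | inj₁ lt        = inj₁ (ℕₚ.≤-<-trans (ℕₚ.≤-reflexive eq) lt)
  ... | inj₁ (eq , d) | inj₂ (eq′ , c′) = inj₂ (trans eq eq′ , d ∷ c′)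
  ... | inj₂ (eq , d) | inj₁ lt        = inj₁ (ℕₚ.<-trans (ℕₚ.≤-reflexive (sym eq)) lt)
  ... | inj₂ (eq , d) | inj₂ (eq′ , _) = inj₁ (ℕₚ.≤-reflexive (trans (sym eq) eq′))
... | inj₁ lt       = ℕₚ.<-irrefl refl lt
... | inj₂ (_ , c′) = D-acyclic i c′

flip-source : {E : Digraph n} {k : Fin n} → Source E k →
              Winds (λ i → 𝟙 (i ≟ k)) E (flip k E)
flip-source {E = E} {k} source = winding go
  where
  go : ∀ {i j} → flip k E i j → (𝟙 (i ≟ k) ≡ 𝟙 (j ≟ k) × E i j) ⊎ (𝟙 (j ≟ k) ≡ suc (𝟙 (i ≟ k)) × E j i)
  go {i} {j} e with i ≟ k | j ≟ k
  ... | yes refl | _        = contradiction e (source _)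
  ... | no _     | yes refl = inj₂ (refl , e)
  ... | no _     | no _     = inj₁ (refl , e)

flip-sink : {E : Digraph n} {k : Fin n} → Sink E k →
            Winds (λ i → 𝟙 (¬? (i ≟ k))) E (flip k E)
flip-sink {E = E} {k} sink = winding go
  where
  go : ∀ {i j} → flip k E i j → (𝟙 (¬? (i ≟ k)) ≡ 𝟙 (¬? (j ≟ k)) × E i j) ⊎
                                (𝟙 (¬? (j ≟ k)) ≡ suc (𝟙 (¬? (i ≟ k))) × E j i)
  go {i} {j} e with i ≟ k | j ≟ k
  ... | yes refl | yes refl = contradiction e (sink _)
  ... | yes refl | no _     = inj₂ (refl , e)
  ... | no _     | yes refl = contradiction e (sink _)
  ... | no _     | no _     = inj₁ (refl , e)

∼⇒Winds : {E F : Digraph n} → E ∼ F → ∃ λ h → Winds h E F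
∼⇒Winds ε = _ , Winds-refl
∼⇒Winds (s ◅ E∼F) with ∼⇒Winds E∼F
... | h , w = step s
  where
  step : {D : Digraph _} → Step D _ → ∃ λ h → Winds h D _
  step (same (_ , E⊆D))                      = _ , Winds-mono E⊆D id w
  step (flipped k (inj₁ source) (_ , E⊆kD)) = _ , Winds-trans (Winds-mono id E⊆kD (flip-source source)) w
  step (flipped k (inj₂ sink) (_ , E⊆kD))   = _ , Winds-trans (Winds-mono id E⊆kD (flip-sink sink)) w

flip-at : (k : Fin n) (E : Digraph n) → ∀ {i j} → i ≡ k ⊎ j ≡ k → flip k E i j ≡ E j i
flip-at k E {i} {j} _ with i ≟ k | j ≟ k
flip-at k E _ | yes _ | _ = refl
flip-at k E _ | no _ | yes _ = refl
flip-at k E (inj₁ i≡k) | no i≢k | no _ = contradiction i≡k i≢k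
flip-at k E (inj₂ j≡k) | no _ | no j≢k = contradiction j≡k j≢k

flip-involutive : (k : Fin n) (E F : Digraph n) → flip k E ⇔ F → flip k F ⇔ E
flip-involutive k E F (E⊆F , F⊆E) = to , from
  where
  to : flip k F ⇒ E
  to {i} {j} f with i ≟ k | j ≟ k
  ... | yes i≡k | _       = subst id (flip-at k E (inj₂ i≡k)) (F⊆E f)
  ... | no _    | yes j≡k = subst id (flip-at k E (inj₁ j≡k)) (F⊆E f)
  ... | no i≢k  | no j≢k with F⊆E f
  ...   | e with i ≟ k | j ≟ k
  ...     | yes i≡k | _       = contradiction i≡k i≢k
  ...     | no _    | yes j≡k = contradiction j≡k j≢k
  ...     | no _    | no _    = e
  from : E ⇒ flip k F
  from {i} {j} e with i ≟ k | j ≟ k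
  ... | yes i≡k | _       = E⊆F (subst id (sym (flip-at k E (inj₂ i≡k))) e)
  ... | no _    | yes j≡k = E⊆F (subst id (sym (flip-at k E (inj₁ j≡k))) e)
  ... | no i≢k  | no j≢k  = E⊆F keep
    where
    keep : flip k E i j
    keep with i ≟ k | j ≟ k
    ... | yes i≡k | _       = contradiction i≡k i≢k
    ... | no _    | yes j≡k = contradiction j≡k j≢k
    ... | no _    | no _    = e

Step-sym : {E F : Digraph n} → Step E F → Step F E
Step-sym (same (E⊆F , F⊆E)) = same (F⊆E , E⊆F)
Step-sym {E = E} {F} (flipped k (inj₁ source) E⇔F) =
  flipped k (inj₂ λ i f → source i (subst id (flip-at k E (inj₁ refl)) (proj₂ E⇔F f)))
    (flip-involutive k E F E⇔F)
Step-sym {E = E} {F} (flipped k (inj₂ sink) E⇔F) =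
  flipped k (inj₁ λ i f → sink i (subst id (flip-at k E (inj₂ refl)) (proj₂ E⇔F f)))
    (flip-involutive k E F E⇔F)

∼-sym : {E F : Digraph n} → E ∼ F → F ∼ E
∼-sym ε         = ε
∼-sym (s ◅ E∼F) = ∼-sym E∼F ◅◅ return (Step-sym s)

∼-arc : {E F : Digraph n} → E ∼ F → ∀ {i j} → E i j → F i j ⊎ F j i
∼-arc E∼F e with wind (proj₂ (∼⇒Winds (∼-sym E∼F))) e
... | inj₁ (_ , f) = inj₁ f
... | inj₂ (_ , f) = inj₂ f

∼-underlying : {E F : Digraph n} → E ∼ F → underlying E ⇒ underlying F
∼-underlying E∼F (fwd e) = [ fwd , bwd ]′ (∼-arc E∼F e)
∼-underlying E∼F (bwd e) = [ bwd , fwd ]′ (∼-arc E∼F e)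

-- The toric transitive closure under winding.

-- A path of E as seen in D: the index is the increase of h, hence the number
-- of arcs that are reversed in D.
data Traverse (D : Digraph n) : ℕ → Fin n → Fin n → Set where
  flat : ∀ {i j} → Star D i j → Traverse D 0 i j
  cut  : ∀ {i j p q} → Star D i p → D q p → Star D q j → Traverse D 1 i j
  many : ∀ {i j c} → Traverse D (suc (suc c)) i j

traverse : {D E : Digraph n} {h : Fin n → ℕ} → Winds h D E →
           ∀ {i j} → Star E i j → ∃ λ c → h j ≡ c + h i × Traverse D c i j
traverse DE ε = 0 , refl , flat ε
traverse {D = D} {h = h} DE {i} (e ◅ es) with wind DE e | traverse DE es
... | inj₁ (eq , d) | c , eq′ , t = c , trans eq′ (cong (c +_) (sym eq)) , extend t
  where
  extend : ∀ {c j} → Traverse D c _ j → Traverse D c i j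
  extend (flat s)     = flat (d ◅ s)
  extend (cut s d′ t) = cut (d ◅ s) d′ t
  extend many         = many
... | inj₂ (eq , d) | c , eq′ , t =
  suc c , trans eq′ (trans (cong (c +_) eq) (ℕₚ.+-suc c (h i))) , extend t
  where
  extend : ∀ {c j} → Traverse D c _ j → Traverse D (suc c) i j
  extend (flat s)    = cut ε d s
  extend (cut _ _ _) = many
  extend many        = many

-- For the turn counts at the four marked vertices of `Cl`: the increases over the three segments
-- add up to the increase over the closing arc.
+-chain : ∀ {a b c d x y z u} → y ≡ a + x → z ≡ b + y → u ≡ c + z → u ≡ d + x → c + b + a ≡ d
+-chain {a} {b} {c} {d} {x} refl refl refl eq =
  ℕₚ.+-cancelʳ-≡ x (c + b + a) d
    (trans (ℕₚ.+-assoc (c + b) a x) (trans (ℕₚ.+-assoc c b (a + x)) eq))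

-- The toric transitive closure with walks in place of the lists of
-- `toricClosure`: y, i, j, z lie in this order on a path closed up by y → z.
Cl : Digraph n → Digraph n
Cl E i j = i ≢ j × ∃₂ λ y z → Star E y i × Star E i j × Star E j z × E y z

-- The closing arc y → z bounds the number of reversed arcs on y ⋯ z by one, and
-- a path with one reversed arc is a cyclic rotation of such a path in D.
Winds-Cl : {D E : Digraph n} {h : Fin n → ℕ} → Winds h D E → Winds h (Cl D) (Cl E)
Winds-Cl {D = D} {E} {h} DE = winding close
  where
  close : ∀ {i j} → Cl E i j → (h i ≡ h j × Cl D i j) ⊎ (h j ≡ suc (h i) × Cl D j i)
  close {i} {j} (i≢j , y , z , s₁ , s₂ , s₃ , e)
    with traverse DE s₁ | traverse DE s₂ | traverse DE s₃ | wind DE e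
  ... | _ , eq₁ , t₁ | _ , eq₂ , t₂ | _ , eq₃ , t₃ | inj₁ (eq , d) =
    join t₁ t₂ t₃ eq₂ (+-chain eq₁ eq₂ eq₃ (sym eq))
    where
    join : ∀ {c₁ c₂ c₃} → Traverse D c₁ y i → Traverse D c₂ i j → Traverse D c₃ j z →
           h j ≡ c₂ + h i → c₃ + c₂ + c₁ ≡ 0 →
           (h i ≡ h j × Cl D i j) ⊎ (h j ≡ suc (h i) × Cl D j i)
    join (flat s₁) (flat s₂) (flat s₃) eq _ = inj₁ (sym eq , i≢j , y , z , s₁ , s₂ , s₃ , d)
  ... | _ , eq₁ , t₁ | _ , eq₂ , t₂ | _ , eq₃ , t₃ | inj₂ (eq , d) =
    join t₁ t₂ t₃ eq₂ (+-chain eq₁ eq₂ eq₃ eq)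
    where
    join : ∀ {c₁ c₂ c₃} → Traverse D c₁ y i → Traverse D c₂ i j → Traverse D c₃ j z →
           h j ≡ c₂ + h i → c₃ + c₂ + c₁ ≡ 1 →
           (h i ≡ h j × Cl D i j) ⊎ (h j ≡ suc (h i) × Cl D j i)
    -- The reversed arc `d′` becomes the new closing arc, and the old one, now z → y, becomes part
    -- of the path. Only a cut between i and j makes j come before i.
    join (cut s d′ s′) (flat s₂) (flat s₃) eq _ =
      inj₁ (sym eq , i≢j , _ , _ , s′ , s₂ , s₃ ◅◅ d ◅ s , d′)
    join (flat s₁) (cut s d′ s′) (flat s₃) eq _ =
      inj₂ (eq , i≢j ∘ sym , _ , _ , s′ , s₃ ◅◅ d ◅ s₁ , s , d′)
    join (flat s₁) (flat s₂) (cut s d′ s′) eq _ =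
      inj₁ (sym eq , i≢j , _ , _ , s′ ◅◅ d ◅ s₁ , s₂ , s , d′)

Star⁺ : {E : Digraph n} → ∀ {i j k} → E i j → Star E j k → TransClosure E i k
Star⁺ e ε        = [ e ]
Star⁺ e (f ◅ es) = e ∷ Star⁺ f es

⁺Star : {E : Digraph n} → ∀ {i j} → TransClosure E i j → Star E i j
⁺Star [ e ]    = return e
⁺Star (e ∷ es) = e ◅ ⁺Star es

-- The closing arc of the outer path is itself a chord of a path closed by a genuine arc `e`;
-- prolonging by `t₁` and `t₃` puts i and j on a path closed by `e`.
Cl-idem : {E : Digraph n} → Cl (Cl E) ⇒ Cl E
Cl-idem (i≢j , _ , _ , s₁ , s₂ , s₃ , (_ , y , z , t₁ , t₂ , t₃ , e)) =
  i≢j , y , z , t₁ ◅◅ un s₁ , un s₂ , un s₃ ◅◅ t₃ , e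
  where un = (λ { (_ , _ , _ , _ , s , _) → s }) ⋆

Cl-mono : {E F : Digraph n} → E ⇒ F → Cl E ⇒ Cl F
Cl-mono E⊆F (i≢j , y , z , s₁ , s₂ , s₃ , e) = i≢j , y , z , m s₁ , m s₂ , m s₃ , E⊆F e
  where m = (return ∘ E⊆F) ⋆

lookup-pair : ∀ {R : Digraph n} {xs i j} → AllPairs R xs → (i ∷ j ∷ []) ⊑ xs → R i j
lookup-pair (_ ∷ Rxs) (_ Sublist.∷ʳ sub)       = lookup-pair Rxs sub
lookup-pair (Rx ∷ _)  (refl Sublist.∷ sub)     = All.lookup Rx (Sublist.to∈ sub)

lookup-last : ∀ {R : Digraph n} {z j} xs → AllPairs R (xs ∷ʳ z) → j ∈ˡ (xs ∷ʳ z) → j ≡ z ⊎ R j z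
lookup-last []       _          (here refl) = inj₁ refl
lookup-last (x ∷ xs) (Rx ∷ _)   (here refl) = inj₂ (All.lookup Rx (last∈ xs))
  where
  last∈ : ∀ xs {z : Fin n} → z ∈ˡ (xs ∷ʳ z)
  last∈ []       = here refl
  last∈ (_ ∷ xs) = there (last∈ xs)
lookup-last (x ∷ xs) (_ ∷ Rxs)  (there j∈)  = lookup-last xs Rxs j∈

-- Brings lifts and acyclicity from `Cl` to `toricClosure`, since both pass to subrelations.
toricClosure⇒Cl : {E : Digraph n} → Acyclic E → toricClosure E ⇒ Cl E
toricClosure⇒Cl acyclic (inj₁ e) =
  (λ { refl → acyclic _ [ e ] }) , _ , _ , ε , return e , ε , e
toricClosure⇒Cl acyclic (inj₂ (_ , single y , (_ Sublist.∷ʳ ())))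
toricClosure⇒Cl acyclic (inj₂ (_ , single y , (_ Sublist.∷ ())))
toricClosure⇒Cl {E = E} acyclic {i} {j} (inj₂ (_ , path y ys z unique linked e , sub)) =
  lookup-pair unique sub , y , z ,
  first (Sublist.to∈ (Sublist.⊆-trans (refl Sublist.∷ (_ Sublist.∷ʳ Sublist.[])) sub)) , lookup-pair paths sub ,
  [ (λ { refl → ε }) , id ]′ (lookup-last (y ∷ ys) paths (Sublist.to∈ (∷ˡ⁻ sub))) , e
  where
  paths : AllPairs (Star E) (y ∷ (ys ∷ʳ z))
  paths = Linked⇒AllPairs _◅◅_ (Linked.map return linked)
  first : i ∈ˡ y ∷ (ys ∷ʳ z) → Star E y i
  first (here refl) = ε
  first (there i∈)  = All.lookup (AllPairs.head paths) i∈

-- Increasing orientations and their recovery by flips.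

Increasing : (Fin n → ℕ) → Digraph n
Increasing p i j = p i ℕ.< p j

Increasing-Star : (p : Fin n → ℕ) → ∀ {i j} → Star (Increasing p) i j → p i ℕ.≤ p j
Increasing-Star p ε        = ℕₚ.≤-refl
Increasing-Star p (d ◅ ds) = ℕₚ.≤-trans (ℕₚ.<⇒≤ d) (Increasing-Star p ds)

Increasing-Cl : (p : Fin n → ℕ) → Cl (Increasing p) ⇒ Increasing p
Increasing-Cl p (i≢j , _ , _ , _ , ε , _)      = contradiction refl i≢j
Increasing-Cl p (_ , _ , _ , _ , d ◅ ds , _) = ℕₚ.<-≤-trans d (Increasing-Star p ds)

Increasing-acyclic : (p : Fin n → ℕ) → Acyclic (Increasing p)
Increasing-acyclic p i c = ℕₚ.<-irrefl refl (lt c)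
  where
  lt : ∀ {i j} → TransClosure (Increasing p) i j → p i ℕ.< p j
  lt [ d ]    = d
  lt (d ∷ ds) = ℕₚ.<-trans d (lt ds)

total : (Fin n → ℕ) → ℕ
total {zero}  f = 0
total {suc n} f = f zero + total (f ∘ suc)

total-mono-≤ : {f g : Fin n → ℕ} → (∀ i → f i ℕ.≤ g i) → total f ℕ.≤ total g
total-mono-≤ {zero}  f≤g = z≤n
total-mono-≤ {suc n} f≤g = ℕₚ.+-mono-≤ (f≤g zero) (total-mono-≤ (f≤g ∘ suc))

total-mono-< : {f g : Fin n → ℕ} → (∀ i → f i ℕ.≤ g i) → ∀ k → f k ℕ.< g k → total f ℕ.< total g
total-mono-< f≤g zero    lt = ℕₚ.+-mono-<-≤ lt (total-mono-≤ (f≤g ∘ suc))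
total-mono-< f≤g (suc k) lt = ℕₚ.+-mono-≤-< (f≤g zero) (total-mono-< (f≤g ∘ suc) k lt)

-- The turns are undone one by one. While `h` is not zero, the vertex with the lexicographically
-- largest turn count and position is a sink, and flipping it lowers its count by one. Once `h`
-- vanishes, every arc increases `p`.
unwind : {E : Digraph n} {p h : Fin n → ℕ} {N : ℕ} → (∀ i → p i ℕ.< N) →
         Winds h (Increasing p) E → ∃ λ F → E ∼ F × F ⇒ Increasing p
unwind {n} {p = p} {N = N} p<N w = go w (<-wellFounded _)
  where
  go : {E : Digraph n} {h : Fin n → ℕ} → Winds h (Increasing p) E → Acc ℕ._<_ (total h) →
       ∃ λ F → E ∼ F × F ⇒ Increasing p
  go {E} {h} w (acc rec) with all? (λ i → h i ℕ.≟ 0)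
  ... | yes h≡0 = E , ε , λ {i} {j} e → case wind w e of λ where
    (inj₁ (_ , d))  → d
    (inj₂ (eq , _)) → contradiction (trans (sym eq) (h≡0 j)) λ ()
  ... | no h≢0 =
    let F , E′∼F , F⊆ = go w′ (rec (total-mono-< h′≤h k h′k<hk))
    in F , flipped k (inj₂ sink) (id , id) ◅ E′∼F , F⊆
    where
    i₀ = proj₁ (¬∀⟶∃¬ n _ (λ i → h i ℕ.≟ 0) h≢0)
    hi₀≢0 = proj₂ (¬∀⟶∃¬ n _ (λ i → h i ℕ.≟ 0) h≢0)
    -- Maximising m is maximising (h , p) lexicographically.
    m : Fin n → ℕ
    m i = h i * N + p i
    k = argmax m i₀ (allFin n)
    m≤mk : ∀ i → m i ℕ.≤ m k
    m≤mk i = All.lookup (f[xs]≤f[argmax] i₀ (allFin n)) (∈-allFin i)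
    h≤hk : ∀ i → h i ℕ.≤ h k
    h≤hk i with h i ℕ.≤? h k
    ... | yes le = le
    ... | no ¬le = contradiction (m≤mk i) (ℕₚ.<⇒≱ (begin-strict
      m k             <⟨ ℕₚ.+-monoʳ-< (h k * N) (p<N k) ⟩
      h k * N + N     ≡⟨ ℕₚ.+-comm (h k * N) N ⟩
      suc (h k) * N   ≤⟨ ℕₚ.*-monoˡ-≤ N (ℕₚ.≰⇒> ¬le) ⟩
      h i * N         ≤⟨ ℕₚ.m≤m+n (h i * N) (p i) ⟩
      m i             ∎))
      where open ℕₚ.≤-Reasoning
    hk>0 : 0 ℕ.< h k
    hk>0 = ℕₚ.<-≤-trans (ℕₚ.n≢0⇒n>0 hi₀≢0) (h≤hk i₀)
    sink : Sink E k
    sink i e with wind w e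
    ... | inj₁ (eq , pk<pi) = ℕₚ.<⇒≱ pk<pi (ℕₚ.+-cancelˡ-≤ (h k * N) _ _
            (subst (λ x → x * N + p i ℕ.≤ m k) (sym eq) (m≤mk i)))
    ... | inj₂ (eq , _)     = ℕₚ.<⇒≱ (ℕₚ.≤-reflexive (sym eq)) (h≤hk i)
    h′ : Fin n → ℕ
    h′ i = h i ℕ.∸ 𝟙 (i ≟ k)
    h′≤h : ∀ i → h′ i ℕ.≤ h i
    h′≤h i = ℕₚ.m∸n≤m (h i) (𝟙 (i ≟ k))
    h′k<hk : h′ k ℕ.< h k
    h′k<hk with k ≟ k
    ... | yes _   = ℕₚ.∸-monoʳ-< (s≤s z≤n) hk>0
    ... | no k≢k  = contradiction refl k≢k
    h+≡1+h′ : ∀ i → h i + 𝟙 (¬? (i ≟ k)) ≡ suc (h′ i)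
    h+≡1+h′ i with i ≟ k
    ... | yes refl = trans (ℕₚ.+-identityʳ (h k)) (sym (ℕₚ.m+[n∸m]≡n hk>0))
    ... | no _     = ℕₚ.+-comm (h i) 1
    w′ : Winds h′ (Increasing p) (flip k E)
    w′ = Winds-pred h+≡1+h′ (Winds-trans w (flip-sink sink))

-- Acyclicity after adding an arc.

addArc-Star : {E : Digraph n} {a b : Fin n} → ∀ {i j} → Star (addArc E a b) i j →
              Star E i j ⊎ (Star E i a × Star E b j)
addArc-Star ε = inj₁ ε
addArc-Star (inj₁ e ◅ es) with addArc-Star es
... | inj₁ s        = inj₁ (e ◅ s)
... | inj₂ (s , s′) = inj₂ (e ◅ s , s′)
addArc-Star (inj₂ (refl , refl) ◅ es) with addArc-Star es
... | inj₁ s        = inj₂ (ε , s)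
-- Whatever lies between the first and the last use of the new arc is dropped.
... | inj₂ (s , s′) = inj₂ (ε , s′)

addArc-acyclic : {E : Digraph n} {a b : Fin n} → Acyclic E → ¬ Star E b a → Acyclic (addArc E a b)
addArc-acyclic {E = E} {a} {b} acyclic ¬ba i c = case c of λ where
    [ e ]    → go e ε
    (e ∷ es) → go e (⁺Star es)
  where
  go : ∀ {k} → addArc E a b i k → ¬ Star (addArc E a b) k i
  go (inj₁ e) es with addArc-Star es
  ... | inj₁ s        = acyclic i (Star⁺ e s)
  ... | inj₂ (s , s′) = ¬ba (s′ ◅◅ e ◅ s)
  go (inj₂ (refl , refl)) es with addArc-Star es
  ... | inj₁ s        = ¬ba s
  ... | inj₂ (s , _)  = ¬ba s

-- Real numbers modulo 1.

ι : ℤ → ℚ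
ι k = k ℚ./ 1

toℚᵘ-ι : ∀ k → toℚᵘ (ι k) ℚᵘ.≃ mkℚᵘ k 0
toℚᵘ-ι k = ℚₚ.toℚᵘ-fromℚᵘ (mkℚᵘ k 0)

ι-neg : ∀ k → ι (ℤ.- k) ≡ ℚ.- ι k
ι-neg k = ℚₚ.toℚᵘ-injective (ℚᵘₚ.≃-trans (toℚᵘ-ι (ℤ.- k))
  (ℚᵘₚ.≃-sym (ℚᵘₚ.≃-trans (ℚₚ.toℚᵘ-homo‿- (ι k)) (ℚᵘₚ.-‿cong (toℚᵘ-ι k)))))

ι-+ : ∀ k m → ι (k ℤ.+ m) ≡ ι k ℚ.+ ι m
ι-+ k m = ℚₚ.toℚᵘ-injective (ℚᵘₚ.≃-trans (toℚᵘ-ι (k ℤ.+ m))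
  (ℚᵘₚ.≃-sym (ℚᵘₚ.≃-trans (ℚₚ.toℚᵘ-homo-+ (ι k) (ι m))
    (ℚᵘₚ.≃-trans (ℚᵘₚ.+-cong (toℚᵘ-ι k) (toℚᵘ-ι m))
      (*≡* (cong (ℤ._* ℤ.+ 1) (cong₂ ℤ._+_ (ℤₚ.*-identityʳ k) (ℤₚ.*-identityʳ m))))))))

1≤ι : ∀ m → 1ℚ ℚ.≤ ι (ℤ.+ suc m)
1≤ι m = ℚₚ.toℚᵘ-cancel-≤ (ℚᵘₚ.≤-respʳ-≃ (ℚᵘₚ.≃-sym (toℚᵘ-ι (ℤ.+ suc m))) (*≤* (+≤+ (s≤s z≤n))))

Lower<Upper : ∀ x {q r} → Lower x q → Upper x r → q ℚ.< r
Lower<Upper x {q} {r} l u with ℚₚ.<-cmp q r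
... | tri< q<r _ _  = q<r
... | tri≈ _ refl _ = contradiction (l , u) (disjoint x)
... | tri> _ _ r<q  = contradiction (l , upperClosed x r<q u) (disjoint x)

-- `_≤_` speaks of lower cuts only; openness of the upper cut of y and locatedness of x carry it
-- over to upper cuts.
≤⇒Upper : ∀ {x y} → x ≤ y → ∀ {q} → Upper y q → Upper x q
≤⇒Upper {x} {y} x≤y u with upperOpen y u
... | q , q<r , u′ with located x q<r
...   | inj₁ l = contradiction (x≤y l , u′) (disjoint y)
...   | inj₂ v = v

<-asym : ∀ {x y} → x < y → ¬ y < x
<-asym {x} {y} (q , xq , qy) (r , yr , rx) =
  ℚₚ.<-asym (Lower<Upper y qy yr) (Lower<Upper x rx xq)

<⇒≉ : ∀ {x y} → x < y → ¬ x ≈ y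
<⇒≉ {x} (q , xq , qy) (_ , y≤x) = disjoint x (y≤x qy , xq)

<-resp-≈ : ∀ {x x′ y y′} → x ≈ x′ → y ≈ y′ → x < y → x′ < y′
<-resp-≈ {x} {x′} (_ , x′≤x) (y≤y′ , _) (q , xq , qy) = q , ≤⇒Upper {x′} {x} x′≤x xq , y≤y′ qy

_≡₁_ : Rel ℝ _
x ≡₁ y = ∃ λ k → x ≈ (y +ᵠ ι k)

≈⇒≡₁ : ∀ {x y} → x ≈ y → x ≡₁ y
≈⇒≡₁ {x} {y} (x≤y , y≤x) =
  ℤ.+ 0 , (λ {q} l → subst (Lower y) (sym (ℚₚ.+-identityʳ q)) (x≤y l)) ,
  (λ {q} l → y≤x (subst (Lower y) (ℚₚ.+-identityʳ q) l))

≡₁-sym : ∀ {x y} → x ≡₁ y → y ≡₁ x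
≡₁-sym {x} {y} (k , to , from) =
  ℤ.- k , (λ {q} l → from (subst (Lower y) (sym (shift q)) l)) , (λ {q} l → subst (Lower y) (shift q) (to l))
  where
  open ℚ-Solver.+-*-Solver
  shift : ∀ q → q ℚ.- ι (ℤ.- k) ℚ.- ι k ≡ q
  shift q rewrite ι-neg k = solve 2 (λ q k → q :- (:- k) :- k := q) refl q (ι k)

≡₁-trans : ∀ {x y z} → x ≡₁ y → y ≡₁ z → x ≡₁ z
≡₁-trans {x} {y} {z} (k , to₁ , from₁) (m , to₂ , from₂) =
  k ℤ.+ m , (λ {q} l → subst (Lower z) (shift q) (to₂ (to₁ l))) ,
  (λ {q} l → from₁ (from₂ (subst (Lower z) (sym (shift q)) l)))
  where
  open ℚ-Solver.+-*-Solver
  shift : ∀ q → q ℚ.- ι k ℚ.- ι m ≡ q ℚ.- ι (k ℤ.+ m)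
  shift q rewrite ι-+ k m = solve 3 (λ q k m → q :- k :- m := q :- (k :+ m)) refl q (ι k) (ι m)

InUnit : ℝ → Set
InUnit x = fromℚ 0ℚ ≤ x × x < fromℚ 1ℚ

-- Two points of [0,1) are less than 1 apart, so the integer between them is 0.
≡₁⇒≈ : ∀ {x y} → InUnit x → InUnit y → x ≡₁ y → x ≈ y
≡₁⇒≈ {x} {y} x∈ y∈ (k , to , from) = by k refl
  where
  impossible : ∀ {x y} m → InUnit x → InUnit y → ¬ (y +ᵠ ι (ℤ.+ suc m)) ≤ x
  -- The bound `u` lies above x and below 1, so `u` minus the shift is negative, hence below y; then
  -- `u` lies below the shifted y and so below x.
  impossible {x} m (_ , u , xu , u<1) (0≤y , _) y+k≤x =
    disjoint x (y+k≤x (0≤y (subst (u ℚ.- ι (ℤ.+ suc m) ℚ.<_) (ℚₚ.+-inverseʳ (ι (ℤ.+ suc m)))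
      (ℚₚ.+-monoˡ-< (ℚ.- ι (ℤ.+ suc m)) (ℚₚ.<-≤-trans u<1 (1≤ι m))))) , xu)
  by : ∀ k′ → k ≡ k′ → x ≈ y
  by (ℤ.+ zero)  refl = (λ {q} l → subst (Lower y) (ℚₚ.+-identityʳ q) (to l)) ,
                        (λ {q} l → from (subst (Lower y) (sym (ℚₚ.+-identityʳ q)) l))
  by (ℤ.+ suc m) refl = ⊥-elim (impossible {x} {y} m x∈ y∈ from)
  by -[1+ m ]    refl = ⊥-elim (impossible {y} {x} m y∈ x∈ (proj₂ (proj₂ (≡₁-sym {x} {y} (k , to , from)))))

module _ (L : ℕ) where
  abstract
    -- p / (1 + L)
    frac : ℕ → ℚ
    frac p = fromℚᵘ (mkℚᵘ (ℤ.+ p) L)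

    frac-< : ∀ {p q} → p ℕ.< q → frac p ℚ.< frac q
    frac-< {p} {q} p<q = ℚₚ.toℚᵘ-cancel-<
      (ℚᵘₚ.<-respˡ-≃ (ℚᵘₚ.≃-sym (ℚₚ.toℚᵘ-fromℚᵘ (mkℚᵘ (ℤ.+ p) L)))
        (ℚᵘₚ.<-respʳ-≃ (ℚᵘₚ.≃-sym (ℚₚ.toℚᵘ-fromℚᵘ (mkℚᵘ (ℤ.+ q) L)))
          (*<* (ℤₚ.*-monoʳ-<-pos (ℤ.+ suc L) (+<+ p<q)))))

    0≤frac : ∀ p → 0ℚ ℚ.≤ frac p
    0≤frac p = ℚₚ.toℚᵘ-cancel-≤ (ℚᵘₚ.≤-respʳ-≃ (ℚᵘₚ.≃-sym (ℚₚ.toℚᵘ-fromℚᵘ (mkℚᵘ (ℤ.+ p) L)))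
      (*≤* (ℤₚ.≤-trans (ℤₚ.≤-reflexive (ℤₚ.*-zeroˡ (ℤ.+ suc L))) (ℤₚ.≤-trans (+≤+ z≤n) (ℤₚ.≤-reflexive (sym (ℤₚ.*-identityʳ (ℤ.+ p))))))))

    frac<1 : ∀ {p} → p ℕ.< suc L → frac p ℚ.< 1ℚ
    frac<1 {p} p<N = ℚₚ.toℚᵘ-cancel-< (ℚᵘₚ.<-respˡ-≃ (ℚᵘₚ.≃-sym (ℚₚ.toℚᵘ-fromℚᵘ (mkℚᵘ (ℤ.+ p) L)))
      (*<* (subst₂ ℤ._<_ (sym (ℤₚ.*-identityʳ (ℤ.+ p))) (sym (ℤₚ.*-identityˡ (ℤ.+ suc L))) (+<+ p<N))))

fromℚ-< : ∀ {p q} → p ℚ.< q → fromℚ p < fromℚ q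
fromℚ-< p<q = let r , p<r , r<q = ℚₚ.<-dense p<q in r , p<r , r<q

-- Positions in a total order and their rotation.

-- The junk value for i outside the list is its length.
pos : List (Fin n) → Fin n → ℕ
pos []       i = 0
pos (x ∷ xs) i = if does (x ≟ i) then 0 else suc (pos xs i)

pos≤length : (xs : List (Fin n)) → ∀ i → pos xs i ℕ.≤ length xs
pos≤length []       i = z≤n
pos≤length (x ∷ xs) i with x ≟ i
... | yes _ = z≤n
... | no _  = s≤s (pos≤length xs i)

pos-AllPairs : {xs : List (Fin n)} → Unique xs → AllPairs (Increasing (pos xs)) xs
pos-AllPairs []                       = []
pos-AllPairs {xs = x ∷ xs} (x∉ ∷ uniq) =
  All.map head-< x∉ ∷ AllPairs.map tail-< (AllPairs.zip (both x∉ , pos-AllPairs uniq))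
  where
  both : ∀ {P : Fin _ → Set} {ys} → All P ys → AllPairs (λ i j → P i × P j) ys
  both []        = []
  both (py ∷ ps) = All.map (py ,_) ps ∷ both ps
  head-< : ∀ {i} → x ≢ i → pos (x ∷ xs) x ℕ.< pos (x ∷ xs) i
  head-< {i} x≢i with x ≟ x | x ≟ i
  ... | no x≢x | _       = contradiction refl x≢x
  ... | yes _  | yes x≡i = contradiction x≡i x≢i
  ... | yes _  | no _    = s≤s z≤n
  tail-< : ∀ {i j} → (x ≢ i × x ≢ j) × pos xs i ℕ.< pos xs j → pos (x ∷ xs) i ℕ.< pos (x ∷ xs) j
  tail-< {i} {j} ((x≢i , x≢j) , lt) with x ≟ i | x ≟ j
  ... | yes x≡i | _       = contradiction x≡i x≢i
  ... | no _    | yes x≡j = contradiction x≡j x≢j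
  ... | no _    | no _    = s≤s lt

AllPairs-lookup : ∀ {R : Digraph n} {xs i j} → AllPairs R xs → i ∈ˡ xs → j ∈ˡ xs → i ≡ j ⊎ (R i j ⊎ R j i)
AllPairs-lookup (_ ∷ _)   (here refl) (here refl) = inj₁ refl
AllPairs-lookup (Rx ∷ _)  (here refl) (there j∈)  = inj₂ (inj₁ (All.lookup Rx j∈))
AllPairs-lookup (Rx ∷ _)  (there i∈)  (here refl) = inj₂ (inj₂ (All.lookup Rx i∈))
AllPairs-lookup (_ ∷ Rxs) (there i∈)  (there j∈)  = AllPairs-lookup Rxs i∈ j∈

AllPairs-++⁻ : ∀ {R : Digraph n} xs {ys} → AllPairs R (xs ++ ys) →
               AllPairs R xs × AllPairs R ys × (∀ {i j} → i ∈ˡ xs → j ∈ˡ ys → R i j)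
AllPairs-++⁻ []       Rys         = [] , Rys , λ ()
AllPairs-++⁻ (x ∷ xs) (Rx ∷ Rxys) =
  let Rxs , Rys , cross = AllPairs-++⁻ xs Rxys in
  All.tabulate (λ i∈ → All.lookup Rx (∈-++⁺ˡ i∈)) ∷ Rxs , Rys , λ where
    (here refl) j∈ → All.lookup Rx (∈-++⁺ʳ xs j∈)
    (there i∈)  j∈ → cross i∈ j∈

module _ (order : TotalOrder n) where
  private
    w : List (Fin n)
    w = proj₁ order

    w↭ : w ↭ allFin n
    w↭ = proj₂ order

  ∈-order : ∀ i → i ∈ˡ w
  ∈-order i = ∈-resp-↭ (↭-sym w↭) (∈-allFin i)

  pos-increasing : AllPairs (Increasing (pos w)) w
  pos-increasing = pos-AllPairs (Permutationₛ.AllPairs-resp-↭ (setoid _) (_∘ sym)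
    ((λ { refl → id }) , (λ { refl → id })) (↭⇒↭ₛ (↭-sym w↭)) (allFin⁺ n))

  pos-total : ∀ {i j} → i ≢ j → pos w i ℕ.< pos w j ⊎ pos w j ℕ.< pos w i
  pos-total {i} {j} i≢j with AllPairs-lookup pos-increasing (∈-order i) (∈-order j)
  ... | inj₁ i≡j = contradiction i≡j i≢j
  ... | inj₂ lt  = lt

  pos-⊆ : {R : Digraph n} → AllPairs R w → Increasing (pos w) ⇒ R
  pos-⊆ Rw {i} {j} i<j
    with AllPairs-lookup (AllPairs.zip (pos-increasing , Rw)) (∈-order i) (∈-order j)
  ... | inj₁ refl               = contradiction i<j (ℕₚ.<-irrefl refl)
  ... | inj₂ (inj₁ (_ , Rij))   = Rij
  ... | inj₂ (inj₂ (j<i , _))   = contradiction i<j (ℕₚ.<-asym j<i)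

-- Rotation is itself a winding: exactly the pairs across the two blocks are reversed, so the block
-- moved to the front counts as turned once.
rotate : (w : TotalOrder n) → ∀ {w′} → proj₁ w ↻ w′ → ∃ λ (w↭ : w′ ↭ allFin n) →
         ∃ λ h → Winds h (Increasing (pos w′)) (Increasing (pos (proj₁ w)))
rotate {n} (_ , w↭) (us , vs , refl , refl) = w′↭ , h , winding turn
  where
  w′↭ : vs ++ us ↭ allFin n
  w′↭ = ↭-trans (++-comm vs us) w↭
  w w′ : TotalOrder n
  w  = us ++ vs , w↭
  w′ = vs ++ us , w′↭
  h : Fin n → ℕ
  h i = 𝟙 (∈? _≟_ i vs)
  parts  = AllPairs-++⁻ us (pos-increasing w)
  parts′ = AllPairs-++⁻ vs (pos-increasing w′)
  ∈us : ∀ {i} → ¬ i ∈ˡ vs → i ∈ˡ us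
  ∈us {i} i∉vs = [ id , (λ i∈ → contradiction i∈ i∉vs) ]′ (∈-++⁻ us (∈-order w i))
  keep : ∀ {xs i j} → AllPairs (Increasing (pos (us ++ vs))) xs → AllPairs (Increasing (pos (vs ++ us))) xs →
         i ∈ˡ xs → j ∈ˡ xs → Increasing (pos (us ++ vs)) i j → Increasing (pos (vs ++ us)) i j
  keep ps ps′ i∈ j∈ i<j with AllPairs-lookup (AllPairs.zip (ps , ps′)) i∈ j∈
  ... | inj₁ refl             = contradiction i<j (ℕₚ.<-irrefl refl)
  ... | inj₂ (inj₁ (_ , lt))  = lt
  ... | inj₂ (inj₂ (j<i , _)) = contradiction i<j (ℕₚ.<-asym j<i)
  turn : ∀ {i j} → Increasing (pos (us ++ vs)) i j →
         (h i ≡ h j × Increasing (pos (vs ++ us)) i j) ⊎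
         (h j ≡ suc (h i) × Increasing (pos (vs ++ us)) j i)
  turn {i} {j} i<j with ∈? _≟_ i vs | ∈? _≟_ j vs
  ... | yes i∈ | yes j∈ = inj₁ (refl , keep (proj₁ (proj₂ parts)) (proj₁ parts′) i∈ j∈ i<j)
  ... | yes i∈ | no j∉  = contradiction i<j (ℕₚ.<-asym (proj₂ (proj₂ parts) (∈us j∉) i∈))
  ... | no i∉  | yes j∈ = inj₂ (refl , proj₂ (proj₂ parts′) j∈ (∈us i∉))
  ... | no i∉  | no j∉  = inj₁ (refl , keep (proj₁ parts) (proj₁ (proj₂ parts′)) (∈us i∉) (∈us j∉) i<j)

-- Toric total extensions as lifts.

mod1-unique : {x r r′ : Point n} → x mod1= r → x mod1= r′ → ∀ i → r i ≈ r′ i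
mod1-unique {x = x} {r} {r′} (x≡r , r∈) (x≡r′ , r′∈) i =
  ≡₁⇒≈ {r i} {r′ i} (r∈ i) (r′∈ i)
    (≡₁-trans {r i} {x i} {r′ i} (≡₁-sym {x i} {r i} (x≡r i)) (x≡r′ i))

record Lift (p : Fin n → ℕ) (E : Digraph n) : Set where
  constructor lifting
  field
    {turns} : Fin n → ℕ
    winds   : Winds turns (Increasing p) E

Lift-∼ : {E F : Digraph n} {p : Fin n → ℕ} → E ∼ F → Lift p E → Lift p F
Lift-∼ E∼F (lifting w) = lifting (Winds-trans w (proj₂ (∼⇒Winds E∼F)))

Lift-mono : {E F : Digraph n} {p : Fin n → ℕ} → F ⇒ E → Lift p E → Lift p F
Lift-mono F⊆E (lifting w) = lifting (Winds-mono id F⊆E w)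

-- One sample point of the chamber of `w` is enough: the orientation it determines increases along
-- `w`, so it is lifted with no turns, and it is equivalent to `E`.
𝓛tor⇒Lift : {E : Digraph n} (w : TotalOrder n) → 𝓛tor E w → Lift (pos (proj₁ w)) E
𝓛tor⇒Lift {n} {E} (w , w↭) w∈ = Lift-∼ (∼-sym E∼O) (lifting (Winds-mono O⊆ id Winds-refl))
  where
  L : ℕ
  L = length w
  -- Positions are at most `L`, the junk value included, so the denominator 1 + L keeps every
  -- coordinate below 1.
  x : Point n
  x i = fromℚ (frac L (pos w i))
  x-mod1 : x mod1= x
  x-mod1 = (λ i → ≈⇒≡₁ {x i} {x i} (id , id)) ,
           λ i → (λ {q} q<0 → ℚₚ.<-≤-trans q<0 (0≤frac L (pos w i))) ,
                 fromℚ-< (frac<1 L (s≤s (pos≤length w i)))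
  x-< : ∀ {i j} → Increasing (pos w) i j → x i < x j
  x-< i<j = fromℚ-< (frac-< L i<j)
  x∈ : chamber E x
  x∈ = w∈ {x} (x , x-mod1 , w , ([] , w , refl , sym (++-identityʳ w)) , AllPairs.map x-< (pos-increasing (w , w↭)))
  r : Point n
  r = proj₁ (proj₂ x∈)
  r-mod1 : x mod1= r
  r-mod1 = proj₁ (proj₂ (proj₂ x∈))
  E∼O : E ∼ orientation (underlying E) r
  E∼O = proj₂ (proj₂ (proj₂ x∈))
  O⊆ : orientation (underlying E) r ⇒ Increasing (pos w)
  O⊆ {i} {j} (_ , ri<rj) with i ≟ j
  ... | yes refl = contradiction ri<rj λ lt → <-asym {r i} {r i} lt lt
  ... | no i≢j with pos-total (w , w↭) i≢j
  ...   | inj₁ i<j = i<j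
  -- The chamber supplies its own representative `r`, which is comparable with `x` because
  -- representatives in [0,1) are unique up to `_≈_`.
  ...   | inj₂ j<i = ⊥-elim (<-asym {r i} {r j} ri<rj
          (<-resp-≈ {x j} {r j} {x i} {r i} (mod1-unique {x = x} {x} {r} x-mod1 r-mod1 j)
                    (mod1-unique {x = x} {x} {r} x-mod1 r-mod1 i) (x-< j<i)))

-- A point of the chamber lists its coordinates along some rotation `w′`. Composing the lift with
-- this rotation and unwinding gives a member of the class of `E` that increases along `w′`, and
-- this is the orientation determined by the point.
Lift⇒𝓛tor : {E : Digraph n} (w : TotalOrder n) → Lift (pos (proj₁ w)) E → 𝓛tor E w
Lift⇒𝓛tor {n} {E} w (lifting lift) {x} (r , r-mod1 , w′ , w↻w′ , r-increasing) = x∉ , r , r-mod1 , E∼O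
  where
  rotated = rotate w w↻w′
  order : TotalOrder n
  order = w′ , proj₁ rotated
  p : Fin n → ℕ
  p = pos w′
  p⇒r : ∀ {i j} → p i ℕ.< p j → r i < r j
  p⇒r = pos-⊆ order r-increasing
  unwound = unwind (λ i → s≤s (pos≤length w′ i)) (Winds-trans (proj₂ (proj₂ rotated)) lift)
  F = proj₁ unwound
  E∼F = proj₁ (proj₂ unwound)
  F⊆ : F ⇒ Increasing p
  F⊆ = proj₂ (proj₂ unwound)
  E-orient : ∀ {i j} → E i j → r i < r j ⊎ r j < r i
  E-orient e = Sum.map (p⇒r ∘ F⊆) (p⇒r ∘ F⊆) (∼-arc E∼F e)
  F⊆O : F ⇒ orientation (underlying E) r
  F⊆O f = ∼-underlying (∼-sym E∼F) (fwd f) , p⇒r (F⊆ f)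
  O⊆F : orientation (underlying E) r ⇒ F
  O⊆F {i} {j} (e , ri<rj) with ∼-underlying E∼F e
  ... | fwd f = f
  ... | bwd f = ⊥-elim (<-asym {r i} {r j} ri<rj (p⇒r (F⊆ f)))
  E∼O : E ∼ orientation (underlying E) r
  E∼O = E∼F ◅◅ return (same (F⊆O , O⊆F))
  x∉ : x ∉ 𝓐tor (underlying E)
  x∉ (y , x≡y , i , j , e , yi≈yj) = apart (case e of λ { (fwd e) → E-orient e ; (bwd e) → swap (E-orient e) })
    where
    r≡y : ∀ i → r i ≡₁ y i
    r≡y i = ≡₁-trans {r i} {x i} {y i} (≡₁-sym {x i} {r i} (proj₁ r-mod1 i)) (x≡y i)
    ri≈rj : r i ≈ r j
    ri≈rj = ≡₁⇒≈ {r i} {r j} (proj₂ r-mod1 i) (proj₂ r-mod1 j)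
      (≡₁-trans {r i} {y i} {r j} (r≡y i)
        (≡₁-trans {y i} {y j} {r j} (≈⇒≡₁ {y i} {y j} yi≈yj) (≡₁-sym {r j} {y j} (r≡y j))))
    apart : ¬ (r i < r j ⊎ r j < r i)
    apart (inj₁ lt) = <⇒≉ {r i} {r j} lt ri≈rj
    apart (inj₂ lt) = <⇒≉ {r j} {r i} lt (proj₂ ri≈rj , proj₁ ri≈rj)

-- Decidable reachability and a rank function.

-- Paths all of whose inner vertices lie in a given list, as in the
-- Floyd–Warshall algorithm.
Via : Digraph n → List (Fin n) → Digraph n
Via E []       i j = i ≡ j ⊎ E i j
Via E (k ∷ ks) i j = Via E ks i j ⊎ (Via E ks i k × Via E ks k j)

Via? : {E : Digraph n} → Decidable E → ∀ ks → Decidable (Via E ks)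
Via? E? []       i j = (i ≟ j) ⊎-dec E? i j
Via? E? (k ∷ ks) i j = Via? E? ks i j ⊎-dec (Via? E? ks i k ×-dec Via? E? ks k j)

Via⇒Star : {E : Digraph n} → ∀ ks {i j} → Via E ks i j → Star E i j
Via⇒Star []       (inj₁ refl)    = ε
Via⇒Star []       (inj₂ e)       = return e
Via⇒Star (k ∷ ks) (inj₁ v)       = Via⇒Star ks v
Via⇒Star (k ∷ ks) (inj₂ (v , u)) = Via⇒Star ks v ◅◅ Via⇒Star ks u

Via-base : {E : Digraph n} → ∀ ks {i j} → i ≡ j ⊎ E i j → Via E ks i j
Via-base []       v = v
Via-base (k ∷ ks) v = inj₁ (Via-base ks v)

-- Joining two walks may visit the head of the list repeatedly; the loop between the first and the
-- last visit is cut out.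
Via-trans : {E : Digraph n} → ∀ {ks i k j} → k ∈ˡ ks → Via E ks i k → Via E ks k j → Via E ks i j
Via-trans (here refl) u v = inj₂ ([ id , proj₁ ]′ u , [ id , proj₂ ]′ v)
Via-trans (there k∈) (inj₁ u)        (inj₁ v)        = inj₁ (Via-trans k∈ u v)
Via-trans (there k∈) (inj₁ u)        (inj₂ (v , v′)) = inj₂ (Via-trans k∈ u v , v′)
Via-trans (there k∈) (inj₂ (u , u′)) (inj₁ v)        = inj₂ (u , Via-trans k∈ u′ v)
Via-trans (there k∈) (inj₂ (u , u′)) (inj₂ (v , v′)) = inj₂ (u , v′)

Star⇒Via : {E : Digraph n} → ∀ {i j} → Star E i j → Via E (allFin n) i j
Star⇒Via {n} ε        = Via-base (allFin n) (inj₁ refl)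
Star⇒Via {n} (e ◅ es) = Via-trans (∈-allFin _) (Via-base (allFin n) (inj₂ e)) (Star⇒Via es)

Star? : {E : Digraph n} → Decidable E → Decidable (Star E)
Star? {n} E? i j = map′ (Via⇒Star (allFin n)) Star⇒Via (Via? E? (allFin n) i j)

TransClosure? : {E : Digraph n} → Decidable E → Decidable (TransClosure E)
TransClosure? {E = E} E? i j = map′ (λ (_ , e , s) → Star⁺ e s) split (any? λ k → E? i k ×-dec Star? E? k j)
  where
  split : ∀ {i j} → TransClosure E i j → ∃ λ k → E i k × Star E k j
  split [ e ]    = _ , e , ε
  split (e ∷ es) = _ , e , ⁺Star es

𝟙-mono : ∀ {P Q : Set} (P? : Dec P) (Q? : Dec Q) → (P → Q) → 𝟙 P? ℕ.≤ 𝟙 Q?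
𝟙-mono (no _)  _       _   = z≤n
𝟙-mono (yes _) (yes _) _   = s≤s z≤n
𝟙-mono (yes p) (no ¬q) P⇒Q = contradiction (P⇒Q p) ¬q

𝟙-strict : ∀ {P Q : Set} (P? : Dec P) (Q? : Dec Q) → ¬ P → Q → 𝟙 P? ℕ.< 𝟙 Q?
𝟙-strict (yes p) _       ¬p _ = contradiction p ¬p
𝟙-strict (no _)  (yes _) _  _ = s≤s z≤n
𝟙-strict (no _)  (no ¬q) _  q = contradiction q ¬q

-- The rank of a vertex is its number of proper ancestors. Along an arc i → j no ancestor is lost,
-- and i itself is gained by acyclicity.
rank : {E : Digraph n} → IsQuiver E → ∃ λ g → E ⇒ Increasing g
rank {E = E} quiver = g , g-increasing
  where
  open IsQuiver quiver
  _⁺?_ = TransClosure? decidable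
  g : Fin _ → ℕ
  g i = total (λ k → 𝟙 (k ⁺? i))
  g-increasing : E ⇒ Increasing g
  g-increasing {i} {j} e = total-mono-<
    (λ k → 𝟙-mono (k ⁺? i) (k ⁺? j) (_⁺++ [ e ]))
    i (𝟙-strict (i ⁺? i) (i ⁺? j) (acyclic i) [ e ])

-- Ends in different components.

≤total : (f : Fin n → ℕ) → ∀ i → f i ℕ.≤ total f
≤total f zero    = ℕₚ.m≤m+n _ _
≤total f (suc i) = ℕₚ.≤-trans (≤total (f ∘ suc) i) (ℕₚ.m≤n+m _ (f zero))

increasing-⊆ : {E F : Digraph n} (f : Fin n → ℕ) → E ⇒ Increasing f → F ⇒ Increasing f →
               underlying E ⇒ underlying F → E ⇒ F
increasing-⊆ f E⊆ F⊆ uE⊆uF e with uE⊆uF (fwd e)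
... | fwd f′ = f′
... | bwd f′ = ⊥-elim (ℕₚ.<-asym (E⊆ e) (F⊆ f′))

underlying-addArc : {E : Digraph n} {a b : Fin n} → underlying (addArc E a b) ⇒ underlying (addArc E b a)
underlying-addArc (fwd (inj₁ e))             = fwd (inj₁ e)
underlying-addArc (bwd (inj₁ e))             = bwd (inj₁ e)
underlying-addArc (fwd (inj₂ (refl , refl))) = bwd (inj₂ (refl , refl))
underlying-addArc (bwd (inj₂ (refl , refl))) = fwd (inj₂ (refl , refl))

Winds-addArc : {D E : Digraph n} {h : Fin n → ℕ} {a b : Fin n} → Winds h D E →
               (h a ≡ h b × D a b) ⊎ (h b ≡ suc (h a) × D b a) → Winds h D (addArc E a b)
Winds-addArc DE ab = winding λ { (inj₁ e) → wind DE e ; (inj₂ (refl , refl)) → ab }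

module DifferentComponents {Q : Digraph n} (quiver : IsQuiver Q) {a b : Fin n}
                           (a≁b : ¬ SameComponent (underlying Q) a b) where
  open IsQuiver quiver

  adjacent? : Decidable (underlying Q)
  adjacent? i j = map′ [ fwd , bwd ]′ (λ { (fwd e) → inj₁ e ; (bwd e) → inj₂ e })
                       (decidable i j ⊎-dec decidable j i)

  -- Abstract, so that `with` can abstract over it.
  abstract
    component? : ∀ i → Dec (SameComponent (underlying Q) a i)
    component? = Star? adjacent? a

  step : ℕ → ℕ → Fin n → ℕ
  step α β i = if does (component? i) then α else β

  step-a : ∀ α β → step α β a ≡ α
  step-a α β with component? a
  ... | yes _   = refl
  ... | no a≁a = contradiction ε a≁a

  step-b : ∀ α β → step α β b ≡ β
  step-b α β with component? b
  ... | yes a~b = contradiction a~b a≁b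
  ... | no _    = refl

  step-arc : ∀ α β {i j} → Q i j → step α β i ≡ step α β j
  step-arc α β {i} {j} e with component? i | component? j
  ... | yes _   | yes _   = refl
  ... | no _    | no _    = refl
  ... | yes a~i | no a≁j = contradiction (a~i ◅◅ return (fwd e)) a≁j
  ... | no a≁i  | yes a~j = contradiction (a~j ◅◅ return (bwd e)) a≁i

  -- The added counts are constant on components, so no arc is reversed: the component of a turns
  -- independently of the rest.
  Winds-step : ∀ α β → Winds (step α β) Q Q
  Winds-step α β = winding λ e → inj₁ (step-arc α β e , e)

  -- Adding `h b` around a and `h a` elsewhere brings a and b level without subtraction. If b
  -- precedes a in `p`, one more turn of the rest puts b after a.
  Lift-addArc : {p : Fin n → ℕ} → p a ℕ.< p b ⊎ p b ℕ.< p a → Lift p Q → Lift p (addArc Q a b)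
  Lift-addArc (inj₁ a<b) (lifting {h} w) =
    lifting (Winds-addArc (Winds-trans w (Winds-step (h b) (h a))) (inj₁ (level , a<b)))
    where
    level : h a + step (h b) (h a) a ≡ h b + step (h b) (h a) b
    level rewrite step-a (h b) (h a) | step-b (h b) (h a) = ℕₚ.+-comm (h a) (h b)
  Lift-addArc (inj₂ b<a) (lifting {h} w) =
    lifting (Winds-addArc (Winds-trans w (Winds-step (h b) (suc (h a)))) (inj₂ (level , b<a)))
    where
    level : h b + step (h b) (suc (h a)) b ≡ suc (h a + step (h b) (suc (h a)) a)
    level rewrite step-a (h b) (suc (h a)) | step-b (h b) (suc (h a)) = ℕₚ.+-comm (h b) (suc (h a))

  -- Both quivers are compared with one height `f`. The arc a → b increases `f`, while the quiver
  -- with b → a becomes increasing once the component of a is turned back. The two then have the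
  -- same graph and both increase `f`, so they coincide.
  addArc-∼ : addArc Q b a ∼ addArc Q a b
  addArc-∼ =
    let F , ba∼F , F⊆ = unwind (s≤s ∘ ≤total f) turned
    in ba∼F ◅◅ return (same
      ( increasing-⊆ f F⊆ ab⊆ (underlying-addArc ∘ ∼-underlying (∼-sym ba∼F))
      , increasing-⊆ f ab⊆ F⊆ (∼-underlying ba∼F ∘ underlying-addArc)))
    where
    g = proj₁ (rank quiver)
    -- Chosen so that f a = g a + g b and f b is one more.
    c = step (g b) (suc (g a))
    f : Fin n → ℕ
    f i = g i + c i
    fa<fb : f a ℕ.< f b
    fa<fb rewrite step-a (g b) (suc (g a)) | step-b (g b) (suc (g a)) =
      ℕₚ.≤-reflexive (ℕₚ.+-comm (suc (g a)) (g b))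
    Q⊆ : Q ⇒ Increasing f
    Q⊆ {i} {j} e = ℕₚ.+-mono-<-≤ (proj₂ (rank quiver) e) (ℕₚ.≤-reflexive (step-arc (g b) (suc (g a)) e))
    ab⊆ : addArc Q a b ⇒ Increasing f
    ab⊆ (inj₁ e)             = Q⊆ e
    ab⊆ (inj₂ (refl , refl)) = fa<fb
    turned : Winds (step 1 0) (Increasing f) (addArc Q b a)
    turned = Winds-addArc (Winds-mono Q⊆ id (Winds-step 1 0))
      (inj₂ (trans (step-a 1 0) (cong suc (sym (step-b 1 0))) , fa<fb))

-- Ends in one component: rigidity of lifts.

-- h - k is constant on components, written without subtraction.
Winds-rigid : {D E : Digraph n} {h k : Fin n → ℕ} → (∀ {i j} → D i j → ¬ D j i) →
              Winds h D E → Winds k D E →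
              ∀ {i j} → SameComponent (underlying E) i j → h i + k j ≡ h j + k i
Winds-rigid {D = D} {E} {h} {k} D-asym wh wk ε = refl
Winds-rigid {D = D} {E} {h} {k} D-asym wh wk {i} {l} (_◅_ {j = j} e es) =
  join (edge e) (Winds-rigid D-asym wh wk es)
  where
  arc : ∀ {i j} → E i j → h i + k j ≡ h j + k i
  arc {i} {j} e with wind wh e | wind wk e
  ... | inj₁ (eq , _) | inj₁ (eq′ , _) = cong₂ _+_ eq (sym eq′)
  -- Asymmetry of `D` decides whether an arc is reversed, so both counts jump alike.
  ... | inj₁ (_ , d)  | inj₂ (_ , d′)  = contradiction d′ (D-asym d)
  ... | inj₂ (_ , d)  | inj₁ (_ , d′)  = contradiction d′ (D-asym d)
  ... | inj₂ (eq , _) | inj₂ (eq′ , _) =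
    trans (cong (h i +_) eq′) (trans (ℕₚ.+-suc (h i) (k i)) (cong (_+ k i) (sym eq)))
  edge : ∀ {i j} → underlying E i j → h i + k j ≡ h j + k i
  edge (fwd e) = arc e
  edge (bwd e) = sym (arc e)
  join : h i + k j ≡ h j + k i → h j + k l ≡ h l + k j → h i + k l ≡ h l + k i
  join ij jl = ℕₚ.+-cancelʳ-≡ (h j + k j) _ _ (begin
    h i + k l + (h j + k j)   ≡⟨ exchange (h i) (k l) (h j) (k j) ⟩
    h i + k j + (h j + k l)   ≡⟨ cong₂ _+_ ij jl ⟩
    h j + k i + (h l + k j)   ≡⟨ rotate₃ (h j) (k i) (h l) (k j) ⟩
    h l + k i + (h j + k j)   ∎)
    where
    open ≡-Reasoning
    open ℕ-Solver.+-*-Solver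
    exchange : ∀ u v x y → u + v + (x + y) ≡ u + y + (x + v)
    exchange = solve 4 (λ u v x y → u :+ v :+ (x :+ y) := u :+ y :+ (x :+ v)) refl
    rotate₃ : ∀ u v x y → u + v + (x + y) ≡ x + v + (u + y)
    rotate₃ = solve 4 (λ u v x y → u :+ v :+ (x :+ y) := x :+ v :+ (u :+ y)) refl

-- By rigidity b minus a is the same in both lifts, but one arc makes this difference positive and
-- the other makes it negative.
addArc-disjoint : {E : Digraph n} {p : Fin n → ℕ} {a b : Fin n} → SameComponent (underlying E) a b →
                  Lift p (addArc E a b) → ¬ Lift p (addArc E b a)
addArc-disjoint {p = p} {a} {b} a~b (lifting {h} wh) (lifting {k} wk)
  with Winds-rigid ℕₚ.<-asym (Winds-mono id inj₁ wh) (Winds-mono id inj₁ wk) a~b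
     | wind wh (inj₂ (refl , refl)) | wind wk (inj₂ (refl , refl))
... | _     | inj₁ (_ , lt)  | inj₁ (_ , lt′)  = ℕₚ.<-asym lt lt′
... | _     | inj₂ (_ , lt)  | inj₂ (_ , lt′)  = ℕₚ.<-asym lt lt′
... | rigid | inj₁ (eq , _)  | inj₂ (eq′ , _)
  rewrite eq | eq′ = ℕₚ.m≢1+m+n (h b + k b) {0} (trans rigid (trans (ℕₚ.+-suc (h b) (k b)) (cong suc (sym (ℕₚ.+-identityʳ _)))))
... | rigid | inj₂ (eq , _)  | inj₁ (eq′ , _)
  rewrite eq | eq′ = ℕₚ.m≢1+m+n (h a + k a) {0} (trans rigid (cong suc (sym (ℕₚ.+-identityʳ _))))

-- Ends with a common neighbour in the closure.

addArc-cover : {E : Digraph n} {p : Fin n → ℕ} {v a b : Fin n} → E v a → E v b →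
               p a ℕ.< p b ⊎ p b ℕ.< p a → Lift p E →
               Lift p (addArc E a b) ⊎ Lift p (addArc E b a)
addArc-cover va vb a≶b (lifting w) with wind w va | wind w vb
... | inj₁ (eq , _)  | inj₁ (eq′ , _)  = Sum.map
  (λ a<b → lifting (Winds-addArc w (inj₁ (trans (sym eq) eq′ , a<b))))
  (λ b<a → lifting (Winds-addArc w (inj₁ (trans (sym eq′) eq , b<a)))) a≶b
... | inj₂ (eq , _)  | inj₂ (eq′ , _)  = Sum.map
  (λ a<b → lifting (Winds-addArc w (inj₁ (trans eq (sym eq′) , a<b))))
  (λ b<a → lifting (Winds-addArc w (inj₁ (trans eq′ (sym eq) , b<a)))) a≶b
-- The end that is a turn ahead of v precedes v in `p` and the other end follows v, so the new arc
-- must start at the end level with v.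
... | inj₁ (eq , lt) | inj₂ (eq′ , lt′) =
  inj₁ (lifting (Winds-addArc w (inj₂ (trans eq′ (cong suc eq) , ℕₚ.<-trans lt′ lt))))
... | inj₂ (eq , lt) | inj₁ (eq′ , lt′) =
  inj₂ (lifting (Winds-addArc w (inj₂ (trans eq (cong suc eq′) , ℕₚ.<-trans lt lt′))))

Cl-acyclic : {E : Digraph n} → Acyclic E → Acyclic (Cl E)
Cl-acyclic {E = E} acyclic i c = acyclic i (flatten c)
  where
  Cl⇒⁺ : ∀ {i j} → Cl E i j → TransClosure E i j
  Cl⇒⁺ (i≢j , _ , _ , _ , ε , _)    = contradiction refl i≢j
  Cl⇒⁺ (_ , _ , _ , _ , e ◅ es , _) = Star⁺ e es
  flatten : ∀ {i j} → TransClosure (Cl E) i j → TransClosure E i j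
  flatten [ c ]    = Cl⇒⁺ c
  flatten (c ∷ cs) = Cl⇒⁺ c ⁺++ flatten cs

Cl-∼ : {E F : Digraph n} → E ∼ F → ∀ {i j} → Cl E i j → Cl F i j ⊎ Cl F j i
Cl-∼ E∼F c = Sum.map proj₂ proj₂ (wind (Winds-Cl (proj₂ (∼⇒Winds (∼-sym E∼F)))) c)

-- Up to direction, a chord survives in every member of the class and is spanned there by a path, so
-- its two ends alone form a toric chain.
Cl⇒ToricComparable : {E : Digraph n} → ∀ {i j} → Cl E i j → ToricComparable E i j
Cl⇒ToricComparable {E = E} {a} {b} c = ⁅ a ⁆ ∪ₛ ⁅ b ⁆ , chain ,
  x∈p∪q⁺ (inj₁ (x∈⁅x⁆ a)) , x∈p∪q⁺ {p = ⁅ a ⁆} (inj₂ (x∈⁅x⁆ b))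
  where
  comparable : ∀ F → E ∼ F → Comparable F a b
  comparable F E∼F = Sum.map Cl⇒Star Cl⇒Star (Cl-∼ E∼F c)
    where
    Cl⇒Star : ∀ {i j} → Cl F i j → Star F i j
    Cl⇒Star (_ , _ , _ , _ , s , _) = s
  chain : ToricChain E (⁅ a ⁆ ∪ₛ ⁅ b ⁆)
  chain F E∼F i j i∈ j∈ with split i i∈ | split j j∈
    where
    split : ∀ i → i ∈ₛ ⁅ a ⁆ ∪ₛ ⁅ b ⁆ → i ≡ a ⊎ i ≡ b
    split i i∈ = Sum.map (x∈⁅y⁆⇒x≡y a) (x∈⁅y⁆⇒x≡y b) (x∈p∪q⁻ ⁅ a ⁆ ⁅ b ⁆ i∈)
  ... | inj₁ refl | inj₁ refl = inj₁ ε
  ... | inj₂ refl | inj₂ refl = inj₁ ε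
  ... | inj₁ refl | inj₂ refl = comparable F E∼F
  ... | inj₂ refl | inj₁ refl = swap (comparable F E∼F)

module CommonNeighbour {Q : Digraph n} (quiver : IsQuiver Q) {Q′ : Digraph n} (Q̄∼Q′ : toricClosure Q ∼ Q′) where
  open IsQuiver quiver

  Q̄⊆Cl : toricClosure Q ⇒ Cl Q
  Q̄⊆Cl = toricClosure⇒Cl acyclic

  Q′-acyclic : Acyclic Q′
  Q′-acyclic = Winds-acyclic (Winds-mono Q̄⊆Cl id (proj₂ (∼⇒Winds Q̄∼Q′))) (Cl-acyclic acyclic)

  -- `Winds-Cl` closes both sides, and the order of positions absorbs its own closure, so a lift of
  -- `Q` is also one of its toric closure.
  Lift-Q′ : {p : Fin n → ℕ} → Lift p Q → Lift p Q′
  Lift-Q′ {p} (lifting w) = Lift-∼ Q̄∼Q′ (lifting (Winds-mono (Increasing-Cl p) Q̄⊆Cl (Winds-Cl w)))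

  Lift-Q : {p : Fin n → ℕ} → Lift p Q′ → Lift p Q
  Lift-Q = Lift-mono inj₁ ∘ Lift-∼ (∼-sym Q̄∼Q′)

  -- A path from b to a would continue v → b and be closed by v → a, making a and b ends of a chord.
  -- Carried back to `Q`, this contradicts toric incomparability.
  Q′-no-path : {a b v : Fin n} → ToricIncomparable Q a b → a ≢ b → Q′ v a → Q′ v b → ¬ Star Q′ b a
  Q′-no-path a∥b a≢b va vb s with Cl-∼ (∼-sym Q̄∼Q′) (a≢b ∘ sym , _ , _ , return vb , s , ε , va)
  ... | inj₂ c = a∥b (Cl⇒ToricComparable (Cl-idem (Cl-mono Q̄⊆Cl c)))
  ... | inj₁ c with Cl⇒ToricComparable (Cl-idem (Cl-mono Q̄⊆Cl c))
  ...   | C , chain , b∈ , a∈ = a∥b (C , chain , a∈ , b∈)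

-- A connected example with proper inclusion.

-- On a → c → d ← b the order (a , b , d , c) lifts to 0, 5, 6, 3 modulo 4, and
-- the distance 5 of the lifts of a and b exceeds 4.
module Example where
  data Q : Digraph 4 where
    a→c : Q 0F 1F
    c→d : Q 1F 2F
    b→d : Q 3F 2F

  h : Fin 4 → ℕ
  h 0F = 0
  h 1F = 0
  h 2F = 1
  h 3F = 1

  w : TotalOrder 4
  w = 0F ∷ 3F ∷ 2F ∷ 1F ∷ [] , prep 0F (↭-reverse (1F ∷ 2F ∷ 3F ∷ []))

  p : Fin 4 → ℕ
  p = pos (proj₁ w)

  Q-decidable : Decidable Q
  Q-decidable 0F 0F = no λ ()
  Q-decidable 0F 1F = yes a→c
  Q-decidable 0F 2F = no λ ()
  Q-decidable 0F 3F = no λ ()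
  Q-decidable 1F 0F = no λ ()
  Q-decidable 1F 1F = no λ ()
  Q-decidable 1F 2F = yes c→d
  Q-decidable 1F 3F = no λ ()
  Q-decidable 2F _  = no λ ()
  Q-decidable 3F 0F = no λ ()
  Q-decidable 3F 1F = no λ ()
  Q-decidable 3F 2F = yes b→d
  Q-decidable 3F 3F = no λ ()

  lift : Winds h (Increasing p) Q
  lift = winding λ where
    a→c → inj₁ (refl , s≤s z≤n)
    c→d → inj₂ (refl , s≤s (s≤s (s≤s z≤n)))
    b→d → inj₁ (refl , s≤s (s≤s z≤n))

  Q-quiver : IsQuiver Q
  -- The lift also certifies acyclicity, since it winds `Q` from an acyclic relation.
  Q-quiver = record { decidable = Q-decidable ; acyclic = Winds-acyclic lift (Increasing-acyclic p) }

  connected : SameComponent (underlying Q) 0F 3F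
  connected = fwd a→c ◅ fwd c→d ◅ bwd b→d ◅ ε

  incomparable : Incomparable Q 0F 3F
  incomparable (inj₁ (a→c ◅ c→d ◅ () ◅ _))
  incomparable (inj₂ (b→d ◅ () ◅ _))

  -- Every lift agrees with `h` up to a constant on the connected graph, so b is always exactly one
  -- turn ahead of a.
  rigid : ∀ {k E} → Q ⇒ E → Winds k (Increasing p) E → k 3F ≡ suc (k 0F)
  rigid Q⊆E w′ = Winds-rigid ℕₚ.<-asym lift (Winds-mono id Q⊆E w′) connected

  ab∉ : ¬ Lift p (addArc Q 0F 3F)
  ab∉ (lifting {k} w′) with rigid inj₁ w′ | wind w′ (inj₂ (refl , refl))
  ... | kb≡1+ka | inj₁ (ka≡kb , _) = ℕₚ.1+n≢n (trans (sym kb≡1+ka) (sym ka≡kb))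
  ... | _       | inj₂ (_ , ())

  ba∉ : ¬ Lift p (addArc Q 3F 0F)
  ba∉ (lifting {k} w′) with rigid inj₁ w′ | wind w′ (inj₂ (refl , refl))
  ... | _       | inj₁ (_ , ())
  ... | kb≡1+ka | inj₂ (ka≡1+kb , _) =
    ℕₚ.m≢1+m+n (k 0F) {1} (trans ka≡1+kb (cong suc (trans kb≡1+ka (ℕₚ.+-comm 1 (k 0F)))))

-- The three parts assembled from the statements about lifts.

theorem7p1 : (∀ (n : ℕ) (Q : Digraph n) → IsQuiver Q → (a b : Fin n) → ToricIncomparable Q a b →
    (¬ SameComponent (underlying Q) a b →
    Acyclic (addArc Q a b) × Acyclic (addArc Q b a) ×
    [ addArc Q a b ]ₜ ≐ [ addArc Q b a ]ₜ ×
    𝓛tor Q ≐ 𝓛tor (addArc Q a b) ×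
    𝓛tor (addArc Q a b) ≐ 𝓛tor (addArc Q b a)) ×
    (SameComponent (underlying Q) a b →
    (Q′ : Digraph n) → Q′ ∈ [ Q ]ₜ → Incomparable Q′ a b →
    Acyclic (addArc Q′ a b) × Acyclic (addArc Q′ b a) ×
    𝓛tor (addArc Q′ a b) ⊆ 𝓛tor Q ×
    𝓛tor (addArc Q′ b a) ⊆ 𝓛tor Q ×
    𝓛tor (addArc Q′ a b) ⊥ 𝓛tor (addArc Q′ b a)) ×
    ((v : Fin n) →
    Distance (underlying (toricClosure Q)) a b 2 →
    underlying (toricClosure Q) a v →
    underlying (toricClosure Q) b v →
    (Q′ : Digraph n) → Q′ ∈ [ toricClosure Q ]ₜ → Source Q′ v →
    Acyclic (addArc Q′ a b) × Acyclic (addArc Q′ b a) ×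
    𝓛tor (addArc Q′ a b) ⊥ 𝓛tor (addArc Q′ b a) ×
    𝓛tor Q ≐ (𝓛tor (addArc Q′ a b) ∪ 𝓛tor (addArc Q′ b a)))) ×
    (Σ ℕ λ n → Σ (Digraph n) λ Q → Σ (Fin n) λ a → Σ (Fin n) λ b → Σ (Digraph n) λ Q′ →
    IsQuiver Q × ToricIncomparable Q a b ×
    SameComponent (underlying Q) a b × Q′ ∈ [ Q ]ₜ × Incomparable Q′ a b ×
    ∃ λ w → w ∈ 𝓛tor Q × w ∉ (𝓛tor (addArc Q′ a b) ∪ 𝓛tor (addArc Q′ b a)))
theorem7p1 = (λ n Q quiver a b a∥b → part-i quiver , part-ii quiver , part-iii quiver a∥b) , proper
  where
  𝓛-mono : ∀ {n} (E F : Digraph n) → (∀ {p} → Lift p E → Lift p F) →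
           ∀ w → w ∈ 𝓛tor E → w ∈ 𝓛tor F
  𝓛-mono E F E⇒F w w∈ {x} = Lift⇒𝓛tor w (E⇒F (𝓛tor⇒Lift w λ {x} → w∈ {x})) {x}

  𝓛-disjoint : ∀ {n} {E : Digraph n} {a b} → SameComponent (underlying E) a b →
               ∀ w → ¬ (w ∈ 𝓛tor (addArc E a b) × w ∈ 𝓛tor (addArc E b a))
  𝓛-disjoint a~b w (w∈ab , w∈ba) = addArc-disjoint a~b (𝓛tor⇒Lift w λ {x} → w∈ab {x}) (𝓛tor⇒Lift w λ {x} → w∈ba {x})

  part-i : ∀ {n} {Q : Digraph n} {a b} → IsQuiver Q → ¬ SameComponent (underlying Q) a b →
           Acyclic (addArc Q a b) × Acyclic (addArc Q b a) ×
           [ addArc Q a b ]ₜ ≐ [ addArc Q b a ]ₜ ×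
           𝓛tor Q ≐ 𝓛tor (addArc Q a b) ×
           𝓛tor (addArc Q a b) ≐ 𝓛tor (addArc Q b a)
  part-i {Q = Q} {a} {b} quiver a≁b =
    addArc-acyclic acyclic (a≁b ∘ Star.reverse bwd) , addArc-acyclic acyclic (a≁b ∘ Star.map fwd) ,
    (addArc-∼ ◅◅_ , ∼-sym addArc-∼ ◅◅_) ,
    ((λ {w} w∈ {x} → Lift⇒𝓛tor w (Lift-addArc (pos-total w a≢b) (𝓛tor⇒Lift w λ {x} → w∈ {x})) {x}) ,
     λ {w} → 𝓛-mono (addArc Q a b) Q (Lift-mono inj₁) w) ,
    ((λ {w} → 𝓛-mono (addArc Q a b) (addArc Q b a) (Lift-∼ (∼-sym addArc-∼)) w) ,
     λ {w} → 𝓛-mono (addArc Q b a) (addArc Q a b) (Lift-∼ addArc-∼) w)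
    where
    open IsQuiver quiver
    open DifferentComponents quiver a≁b
    a≢b : a ≢ b
    a≢b refl = a≁b ε

  part-ii : ∀ {n} {Q : Digraph n} {a b} → IsQuiver Q → SameComponent (underlying Q) a b →
            (Q′ : Digraph n) → Q′ ∈ [ Q ]ₜ → Incomparable Q′ a b →
            Acyclic (addArc Q′ a b) × Acyclic (addArc Q′ b a) ×
            𝓛tor (addArc Q′ a b) ⊆ 𝓛tor Q ×
            𝓛tor (addArc Q′ b a) ⊆ 𝓛tor Q ×
            𝓛tor (addArc Q′ a b) ⊥ 𝓛tor (addArc Q′ b a)
  part-ii {Q = Q} {a} {b} quiver a~b Q′ Q∼Q′ a∥b =
    addArc-acyclic Q′-acyclic (a∥b ∘ inj₂) , addArc-acyclic Q′-acyclic (a∥b ∘ inj₁) ,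
    (λ {w} → 𝓛-mono (addArc Q′ a b) Q (Lift-∼ (∼-sym Q∼Q′) ∘ Lift-mono inj₁) w) ,
    (λ {w} → 𝓛-mono (addArc Q′ b a) Q (Lift-∼ (∼-sym Q∼Q′) ∘ Lift-mono inj₁) w) ,
    λ {w} → 𝓛-disjoint (Star.map (∼-underlying Q∼Q′) a~b) w
    where
    Q′-acyclic = Winds-acyclic (proj₂ (∼⇒Winds Q∼Q′)) (IsQuiver.acyclic quiver)

  part-iii : ∀ {n} {Q : Digraph n} {a b} → IsQuiver Q → ToricIncomparable Q a b → (v : Fin n) →
             Distance (underlying (toricClosure Q)) a b 2 →
             underlying (toricClosure Q) a v →
             underlying (toricClosure Q) b v →
             (Q′ : Digraph n) → Q′ ∈ [ toricClosure Q ]ₜ → Source Q′ v →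
             Acyclic (addArc Q′ a b) × Acyclic (addArc Q′ b a) ×
             𝓛tor (addArc Q′ a b) ⊥ 𝓛tor (addArc Q′ b a) ×
             𝓛tor Q ≐ (𝓛tor (addArc Q′ a b) ∪ 𝓛tor (addArc Q′ b a))
  part-iii {n} {Q} {a} {b} quiver a∥b v distance av bv Q′ Q̄∼Q′ source =
    addArc-acyclic Q′-acyclic (Q′-no-path a∥b a≢b va vb) ,
    addArc-acyclic Q′-acyclic (Q′-no-path (a∥b ∘ λ (C , c , b∈ , a∈) → C , c , a∈ , b∈) (a≢b ∘ sym) vb va) ,
    -- The vertices a and b are connected through v, so rigidity applies.
    (λ {w} → 𝓛-disjoint (bwd va ◅ fwd vb ◅ ε) w) ,
    (λ {w} w∈ → Sum.map (Lift⇒𝓛tor w) (Lift⇒𝓛tor w)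
      (addArc-cover va vb (pos-total w a≢b) (Lift-Q′ (𝓛tor⇒Lift w λ {x} → w∈ {x})))) ,
    λ {w} → [ 𝓛-mono (addArc Q′ a b) Q (Lift-Q ∘ Lift-mono inj₁) w
            , 𝓛-mono (addArc Q′ b a) Q (Lift-Q ∘ Lift-mono inj₁) w ]′
    where
    open CommonNeighbour quiver Q̄∼Q′
    from-v : ∀ {i} → underlying (toricClosure Q) i v → Q′ v i
    from-v iv with ∼-underlying Q̄∼Q′ iv
    ... | fwd e = contradiction e (source _)
    ... | bwd e = e
    va = from-v av
    vb = from-v bv
    a≢b : a ≢ b
    -- For a = b the empty walk would force 2 ≤ 0.
    a≢b refl = case proj₂ distance 0 nil of λ ()

  proper : Σ ℕ λ n → Σ (Digraph n) λ Q → Σ (Fin n) λ a → Σ (Fin n) λ b → Σ (Digraph n) λ Q′ →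
           IsQuiver Q × ToricIncomparable Q a b ×
           SameComponent (underlying Q) a b × Q′ ∈ [ Q ]ₜ × Incomparable Q′ a b ×
           ∃ λ w → w ∈ 𝓛tor Q × w ∉ (𝓛tor (addArc Q′ a b) ∪ 𝓛tor (addArc Q′ b a))
  proper = 4 , Q , 0F , 3F , Q , Q-quiver ,
    (λ (_ , chain , a∈ , b∈) → incomparable (chain Q ε 0F 3F a∈ b∈)) ,
    connected , ε , incomparable , w , (λ {x} → Lift⇒𝓛tor w (lifting lift) {x}) ,
    [ (λ w∈ → ab∉ (𝓛tor⇒Lift w λ {x} → w∈ {x})) , (λ w∈ → ba∉ (𝓛tor⇒Lift w λ {x} → w∈ {x})) ]′
    where open Example
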